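{- Let $\mathbb{F}_q$ be a finite field with $q$ elements. Let $p > 0$, $n > 0$ and $k \geq 0$ be integers, and let $\lambda = (p+(k-1)n,\ p+(k-2)n,\ \ldots,\ p+n,\ p)$ be the $p$-shifted $n$-staircase of length $k$. (i) Assume that $k < n+1$ (with $p$ arbitrary). Then $$P(s_{\lambda} \mapsto 0) = 1 - \begin{cases} \prod\limits_{i=1}^{k-1} \left(1-\dfrac{1}{q^{i}}\right), & \text{if } p \leq k-1; \\ \prod\limits_{i=1}^{k} \left(1-\dfrac{1}{q^{i}}\right), & \text{if } p > k-1. \end{cases}$$ (ii) Assume that $p \leq n$ and $k \geq n+1$. Then $$P(s_{\lambda} \mapsto 0) = 1- \prod_{i=1}^{n} \left(1-\frac{1}{q^{i}}\right).$$
   Context: Let $\mathcal{P} = \mathbb{Z}[h_1, h_2, h_3, \ldots]$ be the polynomial ring in countably many indeterminates, and set $h_0 := 1$ and $h_m := 0$ for $m < 0$. For a partition $\lambda = (\lambda_1, \ldots, \lambda_k)$ of length $k$, the Schur function is $s_\lambda := \det\left( h_{\lambda_i - i + j} \right)_{1\leq i,j\leq k} \in \mathcal{P}$ (the determinant of the $0\times 0$-matrix is $1$). For $f \in \mathcal{P}$ and $a \in \mathbb{F}_q$, choose $N$ such that $f$ involves only $h_1, \ldots, h_N$; then $$P(f \mapsto a) := \frac{\#\{(z_1, \ldots, z_N) \in \mathbb{F}_q^N \mid f(z_1, \ldots, z_N) = a\}}{q^N},$$ where the integer coefficients of $f$ are mapped to $\mathbb{F}_q$. This does not depend on the choice of $N$.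 -}

module Defs where

open import Algebra.Bundles using (CommutativeRing)
import Algebra.Properties.Monoid.Mult as Mult
import Algebra.Properties.Monoid.Sum as MonoidSum
import Algebra.Properties.Ring as RingProperties
import Algebra.Properties.Semiring.Exp as Exp
import Algebra.Properties.Semiring.Mult as SemiringMult
open import Data.Fin.Base using (Fin; zero; suc; toℕ; punchIn)
import Data.Fin.Properties as Fin
open import Data.Integer.Base as ℤ using (ℤ; +_; -[1+_]; 0ℤ; 1ℤ)
import Data.Integer.Properties as ℤ
open import Data.List.Base using (List; []; _∷_; _++_; length; lookup; map; filter; tabulate; applyDownFrom; cartesianProductWith)
import Data.List.Properties as List
open import Data.List.Relation.Unary.All using (All; universal)
import Data.List.Relation.Unary.All.Properties as All
open import Data.List.Relation.Unary.Linked using (Linked)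
import Data.List.Relation.Unary.Linked.Properties as Linked
open import Data.Nat.Base as ℕ using (ℕ; zero; suc; NonZero; s≤s)
import Data.Nat.Properties as ℕ
open import Data.Nat.ListAction using (sum)
open import Data.Product.Base using (∃; _×_; _,_)
open import Data.Rational.Base as ℚ using (ℚ; 1ℚ)
import Data.Rational.Properties as ℚ
open import Data.Rational.Unnormalised.Base using (mkℚᵘ; *≡*)
open import Data.Unit.Base using (⊤; tt)
open import Data.Vec.Base using (Vec; []; _∷_)
open import Function.Base using (_∘_)
open import Function.Bundles using (Inverse)
open import Level using (Level; 0ℓ) renaming (suc to lsuc; _⊔_ to _⊔ˡ_)
open import Relation.Binary.Definitions using (Decidable)
open import Relation.Binary.PropositionalEquality using (_≡_; refl; cong; cong₂; sym; trans; module ≡-Reasoning)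
import Relation.Binary.PropositionalEquality as ≡
open import Relation.Nullary using (¬_; yes; no)
open import Relation.Nullary.Decidable using (map′)
import Relation.Unary as U

private
  variable
    c ℓ : Level

module Determinant (R : CommutativeRing c ℓ) where

  open CommutativeRing R hiding (zero)
  open Exp semiring using (_^_)
  open MonoidSum +-monoid using () renaming (sum to ∑)

  Matrix : ℕ → Set c
  Matrix n = Fin n → Fin n → Carrier

  -- Laplace expansion along the first row.
  det : ∀ {n} → Matrix n → Carrier
  det {zero}  A = 1#
  det {suc n} A = ∑ λ j →
    (- 1#) ^ toℕ j * (A zero j * det (λ r s → A (suc r) (punchIn j s)))

module Fromℤ (R : CommutativeRing c ℓ) where

  open CommutativeRing R hiding (zero) renaming (refl to ≈-refl; sym to ≈-sym; trans to ≈-trans)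
  open SemiringMult semiring using (×1-homo-*)
  open Mult +-monoid using (×-homo-+; ×-congˡ) renaming (_×_ to _·_)
  open RingProperties ring using (-0#≈0#; -‿+-comm; -‿involutive; -‿distribˡ-*; -‿distribʳ-*)
  open import Relation.Binary.Reasoning.Setoid setoid

  fromℤ : ℤ → Carrier
  fromℤ (+ n)    = n · 1#
  fromℤ -[1+ n ] = - (suc n · 1#)

  private
    cancel : ∀ a b d → a + b + - (a + d) ≈ b + - d
    cancel a b d = begin
      a + b + - (a + d)     ≈⟨ +-cong (+-comm a b) (≈-sym (-‿+-comm a d)) ⟩
      b + a + (- a + - d)   ≈⟨ +-assoc b a _ ⟩
      b + (a + (- a + - d)) ≈⟨ +-congˡ (≈-sym (+-assoc a (- a) (- d))) ⟩
      b + (a + - a + - d)   ≈⟨ +-congˡ (+-congʳ (-‿inverseʳ a)) ⟩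
      b + (0# + - d)        ≈⟨ +-congˡ (+-identityˡ (- d)) ⟩
      b + - d               ∎

    fromℤ-⊖ : ∀ m n → fromℤ (m ℤ.⊖ n) ≈ m · 1# + - (n · 1#)
    fromℤ-⊖ zero    zero    = ≈-sym (≈-trans (+-identityˡ _) -0#≈0#)
    fromℤ-⊖ zero    (suc n) = ≈-sym (+-identityˡ _)
    fromℤ-⊖ (suc m) zero    = ≈-sym (≈-trans (+-congˡ -0#≈0#) (+-identityʳ _))
    fromℤ-⊖ (suc m) (suc n) = begin
      fromℤ (suc m ℤ.⊖ suc n)           ≡⟨ cong fromℤ (ℤ.[1+m]⊖[1+n]≡m⊖n m n) ⟩
      fromℤ (m ℤ.⊖ n)                   ≈⟨ fromℤ-⊖ m n ⟩
      m · 1# + - (n · 1#)               ≈⟨ ≈-sym (cancel 1# (m · 1#) (n · 1#)) ⟩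
      suc m · 1# + - (suc n · 1#)       ∎

    fromℤ-neg : ∀ n → fromℤ (ℤ.- + n) ≈ - (n · 1#)
    fromℤ-neg zero    = ≈-sym -0#≈0#
    fromℤ-neg (suc n) = ≈-refl

  fromℤ-+ : ∀ i j → fromℤ (i ℤ.+ j) ≈ fromℤ i + fromℤ j
  fromℤ-+ (+ m)    (+ n)    = ×-homo-+ 1# m n
  fromℤ-+ (+ m)    -[1+ n ] = fromℤ-⊖ m (suc n)
  fromℤ-+ -[1+ m ] (+ n)    = ≈-trans (fromℤ-⊖ n (suc m)) (+-comm _ _)
  fromℤ-+ -[1+ m ] -[1+ n ] = begin
    - (suc (suc (m ℕ.+ n)) · 1#)    ≈⟨ -‿cong (×-congˡ (cong suc (sym (ℕ.+-suc m n)))) ⟩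
    - ((suc m ℕ.+ suc n) · 1#)      ≈⟨ -‿cong (×-homo-+ 1# (suc m) (suc n)) ⟩
    - (suc m · 1# + suc n · 1#)     ≈⟨ ≈-sym (-‿+-comm _ _) ⟩
    - (suc m · 1#) + - (suc n · 1#) ∎

  fromℤ-* : ∀ i j → fromℤ (i ℤ.* j) ≈ fromℤ i * fromℤ j
  fromℤ-* (+ m) (+ n) = begin
    fromℤ (+ m ℤ.* + n)    ≡⟨ cong fromℤ (sym (ℤ.pos-* m n)) ⟩
    (m ℕ.* n) · 1#         ≈⟨ ×1-homo-* m n ⟩
    m · 1# * n · 1#        ∎
  fromℤ-* (+ m) -[1+ n ] = begin
    fromℤ (+ m ℤ.* -[1+ n ])          ≡⟨ cong fromℤ (sym (ℤ.neg-distribʳ-* (+ m) (+ suc n))) ⟩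
    fromℤ (ℤ.- (+ m ℤ.* + suc n))     ≡⟨ cong (fromℤ ∘ ℤ.-_) (sym (ℤ.pos-* m (suc n))) ⟩
    fromℤ (ℤ.- + (m ℕ.* suc n))       ≈⟨ fromℤ-neg (m ℕ.* suc n) ⟩
    - ((m ℕ.* suc n) · 1#)            ≈⟨ -‿cong (×1-homo-* m (suc n)) ⟩
    - (m · 1# * suc n · 1#)           ≈⟨ -‿distribʳ-* _ _ ⟩
    m · 1# * - (suc n · 1#)           ∎
  fromℤ-* -[1+ m ] (+ n) = begin
    fromℤ (-[1+ m ] ℤ.* + n)          ≡⟨ cong fromℤ (sym (ℤ.neg-distribˡ-* (+ suc m) (+ n))) ⟩
    fromℤ (ℤ.- (+ suc m ℤ.* + n))     ≡⟨ cong (fromℤ ∘ ℤ.-_) (sym (ℤ.pos-* (suc m) n)) ⟩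
    fromℤ (ℤ.- + (suc m ℕ.* n))       ≈⟨ fromℤ-neg (suc m ℕ.* n) ⟩
    - ((suc m ℕ.* n) · 1#)            ≈⟨ -‿cong (×1-homo-* (suc m) n) ⟩
    - (suc m · 1# * n · 1#)           ≈⟨ -‿distribˡ-* _ _ ⟩
    - (suc m · 1#) * n · 1#           ∎
  fromℤ-* -[1+ m ] -[1+ n ] = begin
    (suc m ℕ.* suc n) · 1#            ≈⟨ ×1-homo-* (suc m) (suc n) ⟩
    suc m · 1# * suc n · 1#           ≈⟨ ≈-sym (-‿involutive _) ⟩
    - (- (suc m · 1# * suc n · 1#))   ≈⟨ -‿cong (-‿distribˡ-* _ _) ⟩
    - (- (suc m · 1#) * suc n · 1#)   ≈⟨ -‿distribʳ-* _ _ ⟩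
    - (suc m · 1#) * - (suc n · 1#)   ∎

open Fromℤ public

-- Polynomial expressions; `var m` is the indeterminate h_{m+1}.
-- The elements of 𝒫 are expressions modulo _≈ᴾ_, the congruence generated
-- by the commutative ring axioms and the arithmetic of ℤ.

data Poly : Set where
  con     : ℤ → Poly
  var     : ℕ → Poly
  _⊕_ _⊗_ : Poly → Poly → Poly
  ⊝_      : Poly → Poly

infix 8 ⊝_
infixl 7 _⊗_
infixl 6 _⊕_
infix  4 _≈ᴾ_

data _≈ᴾ_ : Poly → Poly → Set where
  ≈ᴾ-refl     : ∀ {f} → f ≈ᴾ f
  ≈ᴾ-sym      : ∀ {f g} → f ≈ᴾ g → g ≈ᴾ f
  ≈ᴾ-trans    : ∀ {f g h} → f ≈ᴾ g → g ≈ᴾ h → f ≈ᴾ h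
  ⊕-cong      : ∀ {f f′ g g′} → f ≈ᴾ f′ → g ≈ᴾ g′ → f ⊕ g ≈ᴾ f′ ⊕ g′
  ⊗-cong      : ∀ {f f′ g g′} → f ≈ᴾ f′ → g ≈ᴾ g′ → f ⊗ g ≈ᴾ f′ ⊗ g′
  ⊝-cong      : ∀ {f f′} → f ≈ᴾ f′ → ⊝ f ≈ᴾ ⊝ f′
  ⊕-assoc     : ∀ f g h → (f ⊕ g) ⊕ h ≈ᴾ f ⊕ (g ⊕ h)
  ⊕-comm      : ∀ f g → f ⊕ g ≈ᴾ g ⊕ f
  ⊕-identityˡ : ∀ f → con 0ℤ ⊕ f ≈ᴾ f
  ⊝-inverseˡ  : ∀ f → ⊝ f ⊕ f ≈ᴾ con 0ℤ
  ⊗-assoc     : ∀ f g h → (f ⊗ g) ⊗ h ≈ᴾ f ⊗ (g ⊗ h)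
  ⊗-comm      : ∀ f g → f ⊗ g ≈ᴾ g ⊗ f
  ⊗-identityˡ : ∀ f → con 1ℤ ⊗ f ≈ᴾ f
  ⊗-distribˡ  : ∀ f g h → f ⊗ (g ⊕ h) ≈ᴾ (f ⊗ g) ⊕ (f ⊗ h)
  con-+       : ∀ i j → con (i ℤ.+ j) ≈ᴾ con i ⊕ con j
  con-*       : ∀ i j → con (i ℤ.* j) ≈ᴾ con i ⊗ con j

𝒫 : CommutativeRing 0ℓ 0ℓ
𝒫 = record
  { Carrier = Poly
  ; _≈_ = _≈ᴾ_
  ; _+_ = _⊕_
  ; _*_ = _⊗_
  ; -_ = ⊝_
  ; 0# = con 0ℤ
  ; 1# = con 1ℤ
  ; isCommutativeRing = record
    { isRing = record
      { +-isAbelianGroup = record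
        { isGroup = record
          { isMonoid = record
            { isSemigroup = record
              { isMagma = record
                { isEquivalence = record
                  { refl = ≈ᴾ-refl ; sym = ≈ᴾ-sym ; trans = ≈ᴾ-trans }
                ; ∙-cong = ⊕-cong
                }
              ; assoc = ⊕-assoc
              }
            ; identity = ⊕-identityˡ
                       , λ f → ≈ᴾ-trans (⊕-comm f _) (⊕-identityˡ f)
            }
          ; inverse = ⊝-inverseˡ
                    , λ f → ≈ᴾ-trans (⊕-comm f _) (⊝-inverseˡ f)
          ; ⁻¹-cong = ⊝-cong
          }
        ; comm = ⊕-comm
        }
      ; *-cong = ⊗-cong
      ; *-assoc = ⊗-assoc
      ; *-identity = ⊗-identityˡ
                   , λ f → ≈ᴾ-trans (⊗-comm f _) (⊗-identityˡ f)
      ; distrib = ⊗-distribˡ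
                , λ f g h → ≈ᴾ-trans (⊗-comm _ f)
                    (≈ᴾ-trans (⊗-distribˡ f g h) (⊕-cong (⊗-comm f g) (⊗-comm f h)))
      }
    ; *-comm = ⊗-comm
    }
  }

-- Only the indeterminates h₁, …, h_N occur in the expression.
Within : ℕ → Poly → Set
Within N (con i) = ⊤
Within N (var m) = m ℕ.< N
Within N (f ⊕ g) = Within N f × Within N g
Within N (f ⊗ g) = Within N f × Within N g
Within N (⊝ f)   = Within N f

-- As an element of 𝒫, f lies in ℤ[h₁, …, h_N].
InvolvesOnly : ℕ → Poly → Set
InvolvesOnly N f = ∃ λ g → f ≈ᴾ g × Within N g

maxIndex : Poly → ℕ
maxIndex (con i) = 0
maxIndex (var m) = suc m
maxIndex (f ⊕ g) = maxIndex f ℕ.⊔ maxIndex g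
maxIndex (f ⊗ g) = maxIndex f ℕ.⊔ maxIndex g
maxIndex (⊝ f)   = maxIndex f

Within-mono : ∀ {M N} → M ℕ.≤ N → ∀ f → Within M f → Within N f
Within-mono M≤N (con i) _       = tt
Within-mono M≤N (var m) m<M     = ℕ.≤-trans m<M M≤N
Within-mono M≤N (f ⊕ g) (u , v) = Within-mono M≤N f u , Within-mono M≤N g v
Within-mono M≤N (f ⊗ g) (u , v) = Within-mono M≤N f u , Within-mono M≤N g v
Within-mono M≤N (⊝ f)   u       = Within-mono M≤N f u

within-maxIndex : ∀ f → Within (maxIndex f) f
within-maxIndex (con i) = tt
within-maxIndex (var m) = ℕ.≤-refl
within-maxIndex (f ⊕ g) =
  Within-mono (ℕ.m≤m⊔n (maxIndex f) (maxIndex g)) f (within-maxIndex f) ,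
  Within-mono (ℕ.m≤n⊔m (maxIndex f) (maxIndex g)) g (within-maxIndex g)
within-maxIndex (f ⊗ g) =
  Within-mono (ℕ.m≤m⊔n (maxIndex f) (maxIndex g)) f (within-maxIndex f) ,
  Within-mono (ℕ.m≤n⊔m (maxIndex f) (maxIndex g)) g (within-maxIndex g)
within-maxIndex (⊝ f)   = within-maxIndex f

involvesOnly-maxIndex : ∀ f → InvolvesOnly (maxIndex f) f
involvesOnly-maxIndex f = f , ≈ᴾ-refl , within-maxIndex f

module Evaluation (R : CommutativeRing c ℓ) where

  open CommutativeRing R hiding (zero) renaming (refl to ≈-refl; sym to ≈-sym; trans to ≈-trans)

  -- `ρ m` is the value substituted for h_{m+1}.
  eval : (ℕ → Carrier) → Poly → Carrier
  eval ρ (con i) = fromℤ R i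
  eval ρ (var m) = ρ m
  eval ρ (f ⊕ g) = eval ρ f + eval ρ g
  eval ρ (f ⊗ g) = eval ρ f * eval ρ g
  eval ρ (⊝ f)   = - eval ρ f

  eval-cong : ∀ ρ {f g} → f ≈ᴾ g → eval ρ f ≈ eval ρ g
  eval-cong ρ ≈ᴾ-refl            = ≈-refl
  eval-cong ρ (≈ᴾ-sym e)         = ≈-sym (eval-cong ρ e)
  eval-cong ρ (≈ᴾ-trans e e′)    = ≈-trans (eval-cong ρ e) (eval-cong ρ e′)
  eval-cong ρ (⊕-cong e e′)      = +-cong (eval-cong ρ e) (eval-cong ρ e′)
  eval-cong ρ (⊗-cong e e′)      = *-cong (eval-cong ρ e) (eval-cong ρ e′)
  eval-cong ρ (⊝-cong e)         = -‿cong (eval-cong ρ e)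
  eval-cong ρ (⊕-assoc f g h)    = +-assoc _ _ _
  eval-cong ρ (⊕-comm f g)       = +-comm _ _
  eval-cong ρ (⊕-identityˡ f)    = +-identityˡ _
  eval-cong ρ (⊝-inverseˡ f)     = -‿inverseˡ _
  eval-cong ρ (⊗-assoc f g h)    = *-assoc _ _ _
  eval-cong ρ (⊗-comm f g)       = *-comm _ _
  eval-cong ρ (⊗-identityˡ f)    = ≈-trans (*-congʳ (+-identityʳ 1#)) (*-identityˡ _)
  eval-cong ρ (⊗-distribˡ f g h) = distribˡ _ _ _
  eval-cong ρ (con-+ i j)        = fromℤ-+ R i j
  eval-cong ρ (con-* i j)        = fromℤ-* R i j

  eval-local : ∀ {N ρ σ} → (∀ m → m ℕ.< N → ρ m ≈ σ m) →
               ∀ f → Within N f → eval ρ f ≈ eval σ f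
  eval-local e (con i) _       = ≈-refl
  eval-local e (var m) m<N     = e m m<N
  eval-local e (f ⊕ g) (u , v) = +-cong (eval-local e f u) (eval-local e g v)
  eval-local e (f ⊗ g) (u , v) = *-cong (eval-local e f u) (eval-local e g v)
  eval-local e (⊝ f)   u       = -‿cong (eval-local e f u)

record Partition : Set where
  field
    parts         : List ℕ
    nonincreasing : Linked ℕ._≥_ parts
    positive      : All (ℕ._> 0) parts

h : ℤ → Poly
h (+ zero)  = con 1ℤ
h (+ suc m) = var m
h -[1+ _ ]  = con 0ℤ

-- Rows and columns are numbered from 0 here; this leaves λᵢ - i + j unchanged.
schur : Partition → Poly
schur μ = det λ i j → h (+ lookup parts i ℤ.- + toℕ i ℤ.+ + toℕ j)
  where
  open Partition μ
  open Determinant 𝒫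

-- The partition (p + (k-1)n, …, p + n, p).
staircase : (p n k : ℕ) → .{{NonZero p}} → Partition
staircase p n k = record
  { parts         = applyDownFrom (λ i → p ℕ.+ i ℕ.* n) k
  ; nonincreasing = Linked.applyDownFrom⁺₂ _ k λ i → ℕ.+-monoʳ-≤ p (ℕ.m≤n+m (i ℕ.* n) n)
  ; positive      = All.applyDownFrom⁺₂ _ k λ i → ℕ.≤-trans (ℕ.>-nonZero⁻¹ p) (ℕ.m≤m+n p (i ℕ.* n))
  }

record FiniteField (q : ℕ) (c ℓ : Level) : Set (lsuc (c ⊔ˡ ℓ)) where
  field
    commutativeRing : CommutativeRing c ℓ

  open CommutativeRing commutativeRing public hiding (refl; sym; trans; zero)
  open CommutativeRing commutativeRing public using ()
    renaming (refl to ≈-refl; sym to ≈-sym; trans to ≈-trans)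

  field
    1≉0         : ¬ 1# ≈ 0#
    inverse     : ∀ x → ¬ x ≈ 0# → ∃ λ y → x * y ≈ 1#
    enumeration : Inverse (≡.setoid (Fin q)) setoid

  open Inverse enumeration public using ()
    renaming (to to element; from to index; from-cong to index-cong; strictlyInverseˡ to element-index)

  infix 4 _≟_
  _≟_ : Decidable _≈_
  x ≟ y = map′ injective index-cong (index x Fin.≟ index y)
    where
    injective : index x ≡ index y → x ≈ y
    injective e = ≈-trans (≈-sym (element-index x))
      (≈-trans (reflexive (cong element e)) (element-index y))

  q-nonZero : NonZero q
  q-nonZero = Fin.nonZeroIndex (index 0#)

  q^-nonZero : ∀ N → NonZero (q ℕ.^ N)
  q^-nonZero N = ℕ.m^n≢0 q N {{q-nonZero}}

  elements : List Carrier
  elements = tabulate element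

  tuples : ∀ N → List (Vec Carrier N)
  tuples zero    = [] ∷ []
  tuples (suc N) = cartesianProductWith _∷_ elements (tuples N)

module Probability {q : ℕ} (F : FiniteField q c ℓ) where

  open FiniteField F
  open Evaluation commutativeRing public

  infixr 5 _◁_
  _◁_ : Carrier → (ℕ → Carrier) → ℕ → Carrier
  (x ◁ ρ) zero    = x
  (x ◁ ρ) (suc m) = ρ m

  -- z₁, …, z_N are substituted for h₁, …, h_N, and 0 for all further
  -- indeterminates; the latter do not matter for f ∈ ℤ[h₁, …, h_N].
  assign : ∀ {N} → Vec Carrier N → ℕ → Carrier
  assign []      = λ _ → 0#
  assign (x ∷ z) = x ◁ assign z

  solutions : ∀ N → Poly → Carrier → List (Vec Carrier N)
  solutions N f a = filter (λ z → eval (assign z) f ≟ a) (tuples N)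

  frequency : ℕ → Poly → Carrier → ℚ
  frequency N f a = (+ length (solutions N f a) ℚ./ q ℕ.^ N) {{q^-nonZero N}}

  -- The choice N = maxIndex f is immaterial, see frequency≡P.
  P : Poly → Carrier → ℚ
  P f a = frequency (maxIndex f) f a

  Event : Set (c ⊔ˡ lsuc ℓ)
  Event = U.Pred (ℕ → Carrier) ℓ

  count : ∀ N {A : Event} → U.Decidable A → ℕ
  count N A? = length (filter (λ z → A? (assign z)) (tuples N))

  Local : ℕ → Event → Set (c ⊔ˡ ℓ)
  Local N A = ∀ ρ σ → (∀ m → m ℕ.< N → ρ m ≈ σ m) → A ρ → A σ

  module _ {N : ℕ} {A : Event} (A? : U.Decidable A) where

    filter-map : ∀ x (zs : List (Vec Carrier N)) →
      length (filter (λ z → A? (assign z)) (map (x ∷_) zs)) ≡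
      length (filter (λ z → A? (x ◁ assign z)) zs)
    filter-map x []       = refl
    filter-map x (z ∷ zs) with A? (x ◁ assign z)
    ... | yes _ = cong suc (filter-map x zs)
    ... | no  _ = filter-map x zs

    filter-product : ∀ xs (zs : List (Vec Carrier N)) →
      length (filter (λ z → A? (assign z)) (cartesianProductWith _∷_ xs zs)) ≡
      sum (map (λ x → length (filter (λ z → A? (x ◁ assign z)) zs)) xs)
    filter-product []       zs = refl
    filter-product (x ∷ xs) zs = begin
      length (filter B? (map (x ∷_) zs ++ rest))                     ≡⟨ cong length (List.filter-++ B? (map (x ∷_) zs) rest) ⟩
      length (filter B? (map (x ∷_) zs) ++ filter B? rest)           ≡⟨ List.length-++ (filter B? (map (x ∷_) zs)) ⟩
      length (filter B? (map (x ∷_) zs)) ℕ.+ length (filter B? rest) ≡⟨ cong₂ ℕ._+_ (filter-map x zs) (filter-product xs zs) ⟩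
      _                                                              ∎
      where
      open ≡-Reasoning
      B? : U.Decidable (λ (z : Vec Carrier (suc N)) → A (assign z))
      B? z = A? (assign z)
      rest = cartesianProductWith _∷_ xs zs

  length-product : ∀ {N} xs (zs : List (Vec Carrier N)) →
    length (cartesianProductWith _∷_ xs zs) ≡ length xs ℕ.* length zs
  length-product []       zs = refl
  length-product (x ∷ xs) zs = begin
    length (map (x ∷_) zs ++ rest)           ≡⟨ List.length-++ (map (x ∷_) zs) ⟩
    length (map (x ∷_) zs) ℕ.+ length rest   ≡⟨ cong₂ ℕ._+_ (List.length-map (x ∷_) zs) (length-product xs zs) ⟩
    length zs ℕ.+ length xs ℕ.* length zs    ∎
    where
    open ≡-Reasoning
    rest = cartesianProductWith _∷_ xs zs

  length-tuples : ∀ N → length (tuples N) ≡ q ℕ.^ N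
  length-tuples zero    = refl
  length-tuples (suc N) = trans (length-product elements (tuples N))
    (cong₂ ℕ._*_ (List.length-tabulate element) (length-tuples N))

  sum-scale : ∀ m (g g′ : Carrier → ℕ) → (∀ x → g x ≡ m ℕ.* g′ x) →
    ∀ xs → sum (map g xs) ≡ m ℕ.* sum (map g′ xs)
  sum-scale m g g′ e []       = sym (ℕ.*-zeroʳ m)
  sum-scale m g g′ e (x ∷ xs) = trans (cong₂ ℕ._+_ (e x) (sum-scale m g g′ e xs))
    (sym (ℕ.*-distribˡ-+ m (g′ x) (sum (map g′ xs))))

  count-stable : ∀ N d {A : Event} (A? : U.Decidable A) → Local N A →
    count (N ℕ.+ d) A? ≡ q ℕ.^ d ℕ.* count N A?
  count-stable zero d {A} A? loc with A? (λ _ → 0#)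
  ... | yes a = trans
          (cong length (List.filter-all B? {tuples d} (universal (λ z → loc _ _ (λ _ ()) a) (tuples d))))
          (trans (length-tuples d) (sym (ℕ.*-identityʳ _)))
    where
    B? : U.Decidable (λ (z : Vec Carrier d) → A (assign z))
    B? z = A? (assign z)
  ... | no ¬a = trans
          (cong length (List.filter-none B? {tuples d} (universal (λ z b → ¬a (loc _ _ (λ _ ()) b)) (tuples d))))
          (sym (ℕ.*-zeroʳ (q ℕ.^ d)))
    where
    B? : U.Decidable (λ (z : Vec Carrier d) → A (assign z))
    B? z = A? (assign z)
  count-stable (suc N) d {A} A? loc = begin
    count (suc N ℕ.+ d) A?                             ≡⟨ filter-product A? elements (tuples (N ℕ.+ d)) ⟩
    sum (map (λ x → count (N ℕ.+ d) (A?′ x)) elements) ≡⟨ sum-scale (q ℕ.^ d) _ _ (λ x → count-stable N d (A?′ x) (loc′ x)) elements ⟩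
    q ℕ.^ d ℕ.* sum (map (λ x → count N (A?′ x)) elements) ≡⟨ cong (q ℕ.^ d ℕ.*_) (sym (filter-product A? elements (tuples N))) ⟩
    q ℕ.^ d ℕ.* count (suc N) A?                       ∎
    where
    open ≡-Reasoning
    A?′ : ∀ x → U.Decidable (λ ρ → A (x ◁ ρ))
    A?′ x ρ = A? (x ◁ ρ)
    loc′ : ∀ x → Local N (λ ρ → A (x ◁ ρ))
    loc′ x ρ σ e = loc (x ◁ ρ) (x ◁ σ) λ where
      zero    _         → ≈-refl
      (suc m) (s≤s m<N) → e m m<N

  scale-/ : ∀ a b m n .{{_ : NonZero m}} .{{_ : NonZero n}} →
    a ℕ.* n ≡ b ℕ.* m → (+ a) ℚ./ m ≡ (+ b) ℚ./ n
  scale-/ a b (suc m) (suc n) e = ℚ.fromℚᵘ-cong {mkℚᵘ (+ a) m} {mkℚᵘ (+ b) n}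
    (*≡* (trans (sym (ℤ.pos-* a (suc n))) (trans (cong +_ e) (ℤ.pos-* b (suc m)))))

  frequency-+ : ∀ N d f a → InvolvesOnly N f → frequency (N ℕ.+ d) f a ≡ frequency N f a
  frequency-+ N d f a (g , f≈g , w) =
    scale-/ (#sol (N ℕ.+ d)) (#sol N) (q ℕ.^ (N ℕ.+ d)) (q ℕ.^ N) {{q^-nonZero (N ℕ.+ d)}} {{q^-nonZero N}} (begin
      #sol (N ℕ.+ d) ℕ.* q ℕ.^ N            ≡⟨ cong (ℕ._* q ℕ.^ N) (count-stable N d (λ ρ → eval ρ f ≟ a) loc) ⟩
      q ℕ.^ d ℕ.* #sol N ℕ.* q ℕ.^ N        ≡⟨ cong (ℕ._* q ℕ.^ N) (ℕ.*-comm (q ℕ.^ d) (#sol N)) ⟩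
      #sol N ℕ.* q ℕ.^ d ℕ.* q ℕ.^ N        ≡⟨ ℕ.*-assoc (#sol N) (q ℕ.^ d) (q ℕ.^ N) ⟩
      #sol N ℕ.* (q ℕ.^ d ℕ.* q ℕ.^ N)      ≡⟨ cong (#sol N ℕ.*_) (sym (ℕ.^-distribˡ-+-* q d N)) ⟩
      #sol N ℕ.* q ℕ.^ (d ℕ.+ N)            ≡⟨ cong (λ e → #sol N ℕ.* q ℕ.^ e) (ℕ.+-comm d N) ⟩
      #sol N ℕ.* q ℕ.^ (N ℕ.+ d)            ∎)
    where
    open ≡-Reasoning
    #sol : ℕ → ℕ
    #sol M = length (solutions M f a)
    loc : Local N (λ ρ → eval ρ f ≈ a)
    loc ρ σ e ρf≈a = ≈-trans (eval-cong σ f≈g)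
      (≈-trans (≈-sym (eval-local e g w))
      (≈-trans (≈-sym (eval-cong ρ f≈g)) ρf≈a))

  frequency≡P : ∀ N f a → InvolvesOnly N f → frequency N f a ≡ P f a
  frequency≡P N f a i = begin
    frequency N f a                ≡⟨ sym (frequency-+ N M f a i) ⟩
    frequency (N ℕ.+ M) f a        ≡⟨ cong (λ K → frequency K f a) (ℕ.+-comm N M) ⟩
    frequency (M ℕ.+ N) f a        ≡⟨ frequency-+ M N f a (involvesOnly-maxIndex f) ⟩
    P f a                          ∎
    where
    open ≡-Reasoning
    M = maxIndex f

  P-cong : ∀ {f g} a → f ≈ᴾ g → P f a ≡ P g a
  P-cong {f} {g} a f≈g = trans (sym (frequency≡P M f a (g , f≈g , within-maxIndex g)))
    (cong (λ m → (+ m ℚ./ q ℕ.^ M) {{q^-nonZero M}})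
      (cong length (List.filter-≐ (λ z → eval (assign z) f ≟ a) (λ z → eval (assign z) g ≟ a)
        ((λ {z} → to z) , (λ {z} → from z)) (tuples M))))
    where
    M = maxIndex g
    to : (z : Vec Carrier M) → eval (assign z) f ≈ a → eval (assign z) g ≈ a
    to z = ≈-trans (≈-sym (eval-cong (assign z) f≈g))
    from : (z : Vec Carrier M) → eval (assign z) g ≈ a → eval (assign z) f ≈ a
    from z = ≈-trans (eval-cong (assign z) f≈g)

  -- ∏_{i=1}^{m} (1 - 1/qⁱ)
  ∏[1-q⁻ⁱ] : ℕ → ℚ
  ∏[1-q⁻ⁱ] zero    = 1ℚ
  ∏[1-q⁻ⁱ] (suc m) = ∏[1-q⁻ⁱ] m ℚ.* (1ℚ ℚ.- (1ℤ ℚ./ q ℕ.^ suc m) {{q^-nonZero (suc m)}})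

{-# OPTIONS --safe #-}

-- Put m = n + 1 and k for the length of λ. From bottom to top, the rows of the Jacobi–Trudi
-- matrix are windows of length k in the sequence … 0, 0, h₀ = 1, h₁, h₂, …, each window m places
-- after the previous one. Read the sequence m values at a time and let X be the space of vectors
-- orthogonal to the windows read so far; as long as these are independent, dim X is the number e
-- of windows to come. Let r be the rank of X on the m coordinates that the fresh values will meet
-- next, and choose a basis of X of which r vectors are in echelon form on these coordinates and
-- the other e - r vanish there, so that their products with the next window are already
-- determined. If one of these products is nonzero, the next window is independent whatever the
-- fresh values are, and r is unchanged. Otherwise it is dependent exactly when the r remaining
-- products vanish, which has probability q⁻ʳ; if it is independent, r drops to r - 1. The second
-- case cannot occur with r = 0 < e, since X would then be stable under a nilpotent shift which is
-- injective on it. Hence, whatever happens on the way, the matrix is nonsingular with conditional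
-- probability ∏_{i ≤ r} (1 - q⁻ⁱ), and it remains to look at the first window.
module Submission where

open import Defs
open import Algebra.Bundles using (CommutativeRing)
import Algebra.Properties.Ring as RingProperties
import Algebra.Properties.Semiring.Exp as Exp
import Algebra.Properties.Semiring.Sum as SemiringSum
open import Data.Bool.Base using (T; true; false; if_then_else_)
open import Data.Empty using (⊥; ⊥-elim)
open import Data.Fin.Base as Fin using (Fin; zero; suc; toℕ; fromℕ<; inject₁; opposite; punchIn; punchOut)
import Data.Fin.Permutation as Permutation
import Data.Fin.Properties as Fin
open import Data.Integer.Base as ℤ using (+_; _⊖_; 1ℤ)
import Data.Integer.Properties as ℤ
import Data.Integer.Tactic.RingSolver as ℤ-Solver
open import Data.List.Base using (length; lookup; map; tabulate; applyDownFrom)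
import Data.List.Properties as List
open import Data.Nat.Base as ℕ using (ℕ; zero; suc; s≤s; NonZero)
open import Data.Nat.ListAction using (sum)
import Data.Nat.Properties as ℕ
import Data.Nat.Tactic.RingSolver as ℕ-Solver
open import Data.Product.Base using (∃; _×_; _,_; proj₁; proj₂)
open import Data.Rational.Base as ℚ using (1ℚ)
import Data.Rational.Properties as ℚ
open import Data.Rational.Unnormalised.Base as ℚᵘ using (mkℚᵘ; *≡*)
import Data.Rational.Unnormalised.Properties as ℚᵘ
open import Data.Sum.Base using (_⊎_; inj₁; inj₂)
open import Data.Unit.Base using (tt)
open import Data.Vec.Base using (Vec; []; _∷_)
open import Data.Vec.Functional using (insertAt)
import Data.Vec.Functional.Properties as Vector
open import Function.Base using (_∘_)
open import Function.Bundles using (module Inverse)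
open import Level using (Level)
open import Relation.Binary.Definitions using (tri<; tri≈; tri>)
open import Relation.Binary.PropositionalEquality as ≡ using (_≡_; _≢_; refl; module ≡-Reasoning)
open import Relation.Nullary using (¬_; Dec; yes; no; ¬?; _×-dec_; _→-dec_)
open import Relation.Nullary.Decidable using (decidable-stable)
import Relation.Unary as U

private
  variable
    c ℓ : Level


-- Determinants: linearity in columns, alternation, Cramer's rule

-- Index form of the fact that deleting either one of two equal adjacent columns leaves the same
-- matrix; it makes the two minors in `det-adjacent` agree.
punchIn-adjacent : ∀ {n} (i : Fin n) s →
  punchIn (inject₁ i) s ≡ punchIn (suc i) s ⊎
  (punchIn (inject₁ i) s ≡ suc i × punchIn (suc i) s ≡ inject₁ i)
punchIn-adjacent zero    zero    = inj₂ (refl , refl)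
punchIn-adjacent zero    (suc s) = inj₁ refl
punchIn-adjacent (suc i) zero    = inj₁ refl
punchIn-adjacent (suc i) (suc s) with punchIn-adjacent i s
... | inj₁ e        = inj₁ (≡.cong suc e)
... | inj₂ (e , e′) = inj₂ (≡.cong suc e , ≡.cong suc e′)

-- Deleting a column outside the adjacent pair leaves the pair adjacent, so the induction in
-- `det-adjacent` reaches the minor.
adjacent-view : ∀ {n} (i : Fin (suc n)) (j : Fin (suc (suc n))) →
  (j ≡ inject₁ i ⊎ j ≡ suc i) ⊎
  ∃ λ i′ → punchIn j (inject₁ i′) ≡ inject₁ i × punchIn j (suc i′) ≡ suc i
adjacent-view zero          zero          = inj₁ (inj₁ refl)
adjacent-view zero          (suc zero)    = inj₁ (inj₂ refl)
adjacent-view {suc n} zero  (suc (suc j)) = inj₂ (zero , refl , refl)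
adjacent-view (suc i)       zero          = inj₂ (i , refl , refl)
adjacent-view {suc n} (suc i) (suc j) with adjacent-view i j
... | inj₁ (inj₁ e)       = inj₁ (inj₁ (≡.cong suc e))
... | inj₁ (inj₂ e)       = inj₁ (inj₂ (≡.cong suc e))
... | inj₂ (i′ , e , e′)  = inj₂ (suc i′ , ≡.cong suc e , ≡.cong suc e′)

module DeterminantProperties (R : CommutativeRing c ℓ) where

  open CommutativeRing R hiding (zero) renaming (refl to ≈-refl; sym to ≈-sym; trans to ≈-trans)
  open Determinant R public
  open Exp semiring using (_^_)
  open SemiringSum semiring renaming (sum to ∑)
  open RingProperties ring using (-1*x≈-x; x+x≈x⇒x≈0)
  open import Relation.Binary.Reasoning.Setoid setoid

  ∑-zero : ∀ {n} (f : Fin n → Carrier) → (∀ i → f i ≈ 0#) → ∑ f ≈ 0#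
  ∑-zero {n} f e = ≈-trans (sum-cong-≋ e) (sum-replicate-zero n)

  ∑-single : ∀ {n} (i : Fin n) (f : Fin n → Carrier) → (∀ j → j ≢ i → f j ≈ 0#) → ∑ f ≈ f i
  ∑-single {suc n} i f e = begin
    ∑ f                      ≈⟨ sum-remove {i = i} f ⟩
    f i + ∑ (f ∘ punchIn i)  ≈⟨ +-congˡ (∑-zero _ λ j → e _ (Fin.punchInᵢ≢i i j)) ⟩
    f i + 0#                 ≈⟨ +-identityʳ _ ⟩
    f i                      ∎

  ∑-adjacent : ∀ {n} (i : Fin n) (f : Fin (suc n) → Carrier) →
    (∀ j → j ≢ inject₁ i → j ≢ suc i → f j ≈ 0#) → f (inject₁ i) + f (suc i) ≈ 0# → ∑ f ≈ 0#
  ∑-adjacent zero f e e′ = begin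
    f zero + (f (suc zero) + ∑ (λ j → f (suc (suc j))))  ≈⟨ +-congˡ (+-congˡ (∑-zero (λ j → f (suc (suc j))) λ j → e (suc (suc j)) (λ ()) (λ ()))) ⟩
    f zero + (f (suc zero) + 0#)                       ≈⟨ +-congˡ (+-identityʳ _) ⟩
    f zero + f (suc zero)                              ≈⟨ e′ ⟩
    0#                                                 ∎
  ∑-adjacent (suc i) f e e′ = begin
    f zero + ∑ (f ∘ suc)  ≈⟨ +-cong (e zero (λ ()) (λ ())) (∑-adjacent i (f ∘ suc) (λ j u v → e (suc j) (u ∘ Fin.suc-injective) (v ∘ Fin.suc-injective)) e′) ⟩
    0# + 0#               ≈⟨ +-identityˡ 0# ⟩
    0#                    ∎

  minor : ∀ {n} → Matrix (suc n) → Fin (suc n) → Matrix n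
  minor A j r s = A (suc r) (punchIn j s)

  term : ∀ {n} → Matrix (suc n) → Fin (suc n) → Carrier
  term A j = (- 1#) ^ toℕ j * (A zero j * det (minor A j))

  term-zero : ∀ {n} (A : Matrix (suc n)) j →
    A zero j ≈ 0# ⊎ det (minor A j) ≈ 0# → term A j ≈ 0#
  term-zero A j (inj₁ e) = ≈-trans (*-congˡ (≈-trans (*-congʳ e) (zeroˡ _))) (zeroʳ _)
  term-zero A j (inj₂ e) = ≈-trans (*-congˡ (≈-trans (*-congˡ e) (zeroʳ _))) (zeroʳ _)

  det-cong : ∀ {n} {A B : Matrix n} → (∀ r s → A r s ≈ B r s) → det A ≈ det B
  det-cong {zero}  e = ≈-refl
  det-cong {suc n} e = sum-cong-≋ λ j → *-congˡ {x = (- 1#) ^ toℕ j}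
    (*-cong (e zero j) (det-cong λ r s → e (suc r) (punchIn j s)))

  -- As `det` expands along the first row, the term at column `c` is linear through its entry, with
  -- the same minor for all three matrices, while every other term is linear through its minor, by
  -- induction.
  det-linear : ∀ {n} (c : Fin n) {A B C : Matrix n} {α} →
    (∀ r j → j ≢ c → A r j ≈ B r j) → (∀ r j → j ≢ c → A r j ≈ C r j) →
    (∀ r → A r c ≈ B r c + α * C r c) → det A ≈ det B + α * det C
  det-linear {suc n} c {A} {B} {C} {α} A≈B A≈C col = begin
    ∑ (term A)                        ≈⟨ sum-cong-≋ each ⟩
    ∑ (λ j → term B j + α * term C j) ≈⟨ ∑-distrib-+ (term B) (λ j → α * term C j) ⟩
    ∑ (term B) + ∑ (λ j → α * term C j) ≈⟨ +-congˡ (≈-sym (*-distribˡ-sum α (term C))) ⟩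
    ∑ (term B) + α * ∑ (term C)       ∎
    where
    swap : ∀ s a d → s * (α * a * d) ≈ α * (s * (a * d))
    swap s a d = begin
      s * (α * a * d)     ≈⟨ *-congˡ (*-assoc α a d) ⟩
      s * (α * (a * d))   ≈⟨ ≈-sym (*-assoc s α _) ⟩
      s * α * (a * d)     ≈⟨ *-congʳ (*-comm s α) ⟩
      α * s * (a * d)     ≈⟨ *-assoc α s _ ⟩
      α * (s * (a * d))   ∎
    each : ∀ j → term A j ≈ term B j + α * term C j
    each j with j Fin.≟ c
    ... | yes refl = begin
      s * (A zero j * det (minor A j))                                     ≈⟨ *-congˡ (*-congʳ (col zero)) ⟩
      s * ((B zero j + α * C zero j) * det (minor A j))                    ≈⟨ *-congˡ (distribʳ _ _ _) ⟩
      s * (B zero j * det (minor A j) + α * C zero j * det (minor A j))             ≈⟨ distribˡ _ _ _ ⟩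
      s * (B zero j * det (minor A j)) + s * (α * C zero j * det (minor A j))       ≈⟨ +-cong (*-congˡ (*-congˡ (det-cong λ r t → A≈B (suc r) _ (Fin.punchInᵢ≢i j t)))) (≈-trans (swap s _ _) (*-congˡ (*-congˡ (*-congˡ (det-cong λ r t → A≈C (suc r) _ (Fin.punchInᵢ≢i j t)))))) ⟩
      term B j + α * term C j                                     ∎
      where
      s = (- 1#) ^ toℕ j
    ... | no j≢c = begin
      s * (A zero j * det (minor A j))                              ≈⟨ *-congˡ (*-congˡ (det-linear c′ {minor A j} {minor B j} {minor C j} {α}
                                                                        (λ r t t≢ → A≈B (suc r) _ (off t≢)) (λ r t t≢ → A≈C (suc r) _ (off t≢)) col′)) ⟩
      s * (A zero j * (det (minor B j) + α * det (minor C j)))        ≈⟨ *-congˡ (distribˡ _ _ _) ⟩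
      s * (A zero j * det (minor B j) + A zero j * (α * det (minor C j)))    ≈⟨ distribˡ _ _ _ ⟩
      s * (A zero j * det (minor B j)) + s * (A zero j * (α * det (minor C j)))  ≈⟨ +-cong (*-congˡ (*-congʳ (A≈B zero j j≢c)))
                                                                            (*-congˡ (≈-trans (≈-sym (*-assoc _ _ _)) (*-congʳ (≈-trans (*-comm _ _) (*-congˡ (A≈C zero j j≢c)))))) ⟩
      term B j + s * (α * C zero j * det (minor C j))               ≈⟨ +-congˡ (swap s _ _) ⟩
      term B j + α * term C j                                     ∎
      where
      s = (- 1#) ^ toℕ j
      c′ = punchOut j≢c
      at-c′ : punchIn j c′ ≡ c
      at-c′ = Fin.punchIn-punchOut j≢c
      off : ∀ {t} → t ≢ c′ → punchIn j t ≢ c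
      off t≢ e = t≢ (Fin.punchIn-injective j _ _ (≡.trans e (≡.sym at-c′)))
      col′ : ∀ r → minor A j r c′ ≈ minor B j r c′ + α * minor C j r c′
      col′ r rewrite at-c′ = col (suc r)

  -- A zero column is the sum of itself and itself, so linearity gives x = x + x for the
  -- determinant.
  det-zero-column : ∀ {n} (c : Fin n) (A : Matrix n) → (∀ r → A r c ≈ 0#) → det A ≈ 0#
  det-zero-column c A e = x+x≈x⇒x≈0 _ (≈-sym (≈-trans
    (det-linear c {A} {A} {A} {1#} (λ _ _ _ → ≈-refl) (λ _ _ _ → ≈-refl) λ r → ≈-sym (≈-trans (+-congˡ (*-identityˡ _)) (≈-trans (+-congˡ (e r)) (+-identityʳ _))))
    (+-congˡ (*-identityˡ _))))

  -- Minors that keep both columns vanish by induction; the two remaining terms have equal entries,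
  -- equal minors and opposite signs.
  det-adjacent : ∀ {n} (i : Fin n) (A : Matrix (suc n)) → (∀ r → A r (inject₁ i) ≈ A r (suc i)) → det A ≈ 0#
  det-adjacent {suc n} i A e = ∑-adjacent i (term A) others pair
    where
    others : ∀ j → j ≢ inject₁ i → j ≢ suc i → term A j ≈ 0#
    others j j≢ j≢′ with adjacent-view i j
    ... | inj₁ (inj₁ eq) = ⊥-elim (j≢ eq)
    ... | inj₁ (inj₂ eq) = ⊥-elim (j≢′ eq)
    ... | inj₂ (i′ , eq , eq′) = term-zero A j (inj₂ (det-adjacent i′ (minor A j) λ r →
            ≈-trans (reflexive (≡.cong (A (suc r)) eq)) (≈-trans (e (suc r)) (reflexive (≡.sym (≡.cong (A (suc r)) eq′))))))
    minors : ∀ r s → A (suc r) (punchIn (suc i) s) ≈ A (suc r) (punchIn (inject₁ i) s)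
    minors r s with punchIn-adjacent i s
    ... | inj₁ eq = reflexive (≡.cong (A (suc r)) (≡.sym eq))
    ... | inj₂ (eq , eq′) = ≈-trans (reflexive (≡.cong (A (suc r)) eq′)) (≈-trans (e (suc r)) (reflexive (≡.cong (A (suc r)) (≡.sym eq))))
    t = (- 1#) ^ toℕ i * (A zero (inject₁ i) * det (minor A (inject₁ i)))
    pair : term A (inject₁ i) + term A (suc i) ≈ 0#
    pair = begin
      term A (inject₁ i) + term A (suc i) ≈⟨ +-cong
          (*-congʳ (reflexive (≡.cong ((- 1#) ^_) (Fin.toℕ-inject₁ i))))
          (≈-trans (*-assoc _ _ _) (≈-trans (-1*x≈-x _) (-‿cong (*-congˡ (*-cong (≈-sym (e zero)) (det-cong minors)))))) ⟩
      t + - t                             ≈⟨ -‿inverseʳ t ⟩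
      0#                                  ∎

  infixl 9 _[_≔_]
  _[_≔_] : ∀ {n} → Matrix n → Fin n → (Fin n → Carrier) → Matrix n
  (A [ c ≔ u ]) r j with j Fin.≟ c
  ... | yes _ = u r
  ... | no  _ = A r j

  ≔-here : ∀ {n} (A : Matrix n) c u r {j} → j ≡ c → (A [ c ≔ u ]) r j ≈ u r
  ≔-here A c u r {j} e with j Fin.≟ c
  ... | yes _ = ≈-refl
  ... | no ≢  = ⊥-elim (≢ e)

  ≔-there : ∀ {n} (A : Matrix n) c u r {j} → j ≢ c → (A [ c ≔ u ]) r j ≈ A r j
  ≔-there A c u r {j} ≢ with j Fin.≟ c
  ... | yes e = ⊥-elim (≢ e)
  ... | no  _ = ≈-refl

  det-add : ∀ {n} (A : Matrix n) c u v α →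
    det (A [ c ≔ (λ r → u r + α * v r) ]) ≈ det (A [ c ≔ u ]) + α * det (A [ c ≔ v ])
  det-add A c u v α = det-linear c
    (λ r j ≢ → ≈-trans (≔-there A c _ r ≢) (≈-sym (≔-there A c _ r ≢)))
    (λ r j ≢ → ≈-trans (≔-there A c _ r ≢) (≈-sym (≔-there A c _ r ≢)))
    λ r → ≈-trans (≔-here A c _ r refl) (≈-sym (+-cong (≔-here A c _ r refl) (*-congˡ (≔-here A c _ r refl))))

  det-combination : ∀ {n l} (A : Matrix n) c (u : Fin l → Fin n → Carrier) (α : Fin l → Carrier) →
    det (A [ c ≔ (λ r → ∑ λ j → α j * u j r) ]) ≈ ∑ λ j → α j * det (A [ c ≔ u j ])
  det-combination {l = zero}  A c u α = det-zero-column c _ λ r → ≔-here A c _ r refl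
  det-combination {l = suc l} A c u α = begin
    det (A [ c ≔ (λ r → α zero * u zero r + ∑ (λ j → α (suc j) * u (suc j) r)) ])
      ≈⟨ det-cong comm ⟩
    det (A [ c ≔ (λ r → ∑ (λ j → α (suc j) * u (suc j) r) + α zero * u zero r) ])
      ≈⟨ det-add A c _ (u zero) (α zero) ⟩
    det (A [ c ≔ (λ r → ∑ (λ j → α (suc j) * u (suc j) r)) ]) + α zero * det (A [ c ≔ u zero ])
      ≈⟨ +-comm _ _ ⟩
    α zero * det (A [ c ≔ u zero ]) + det (A [ c ≔ (λ r → ∑ (λ j → α (suc j) * u (suc j) r)) ])
      ≈⟨ +-congˡ (det-combination A c (u ∘ suc) (α ∘ suc)) ⟩
    _ ∎
    where
    comm : ∀ r s → (A [ c ≔ (λ r → α zero * u zero r + ∑ (λ j → α (suc j) * u (suc j) r)) ]) r s ≈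
                   (A [ c ≔ (λ r → ∑ (λ j → α (suc j) * u (suc j) r) + α zero * u zero r) ]) r s
    comm r s with s Fin.≟ c
    ... | yes _ = +-comm _ _
    ... | no  _ = ≈-refl

  -- Polarization in the adjacent columns j - 1 and j moves the repeated column closer.
  det-repeated-gap : ∀ {n} d {i j : Fin n} (A : Matrix n) → toℕ j ≡ suc (d ℕ.+ toℕ i) →
    (∀ r → A r i ≈ A r j) → det A ≈ 0#
  det-repeated-gap {suc n} zero {i} {suc j} A gap e = det-adjacent j A λ r → ≈-trans (reflexive (≡.cong (A r) i≡)) (e r)
    where
    i≡ : inject₁ j ≡ i
    i≡ = Fin.toℕ-injective (≡.trans (Fin.toℕ-inject₁ j) (ℕ.suc-injective gap))
  det-repeated-gap {suc n} (suc d) {i} {suc j} A gap e = begin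
    det A                                           ≈⟨ ≈-sym (+-identityʳ _) ⟩
    det A + 0#                                      ≈⟨ +-cong (det-cong A≈) (≈-sym yx≈0) ⟩
    det (B x y) + det (B y x)                       ≈⟨ ≈-sym (+-cong (≈-trans (+-congʳ xx≈0) (+-identityˡ _)) (≈-trans (+-congˡ yy≈0) (+-identityʳ _))) ⟩
    (det (B x x) + det (B x y)) + (det (B y x) + det (B y y))   ≈⟨ ≈-sym (+-cong (add₂ x) (add₂ y)) ⟩
    det (B x z) + det (B y z)                       ≈⟨ ≈-sym (add₁ z) ⟩
    det (B z z)                                     ≈⟨ det-adjacent j (B z z) (λ r → ≈-trans (B-k z z r) (≈-sym (B-l z z r))) ⟩
    0#                                              ∎
    where
    k = inject₁ j
    l = suc j
    k≢l : k ≢ l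
    k≢l eq = ℕ.1+n≢n (≡.trans (≡.sym (≡.cong toℕ eq)) (Fin.toℕ-inject₁ j))
    gap′ : toℕ k ≡ suc (d ℕ.+ toℕ i)
    gap′ = ≡.trans (Fin.toℕ-inject₁ j) (ℕ.suc-injective gap)
    i≢k : i ≢ k
    i≢k eq = ℕ.m≢1+n+m (toℕ i) (≡.trans (≡.cong toℕ eq) gap′)
    i≢l : i ≢ l
    i≢l eq = ℕ.m≢1+n+m (toℕ i) (≡.trans (≡.cong toℕ eq) gap)
    x y z : Fin (suc n) → Carrier
    x r = A r k
    y r = A r l
    z r = x r + 1# * y r
    B : (Fin (suc n) → Carrier) → (Fin (suc n) → Carrier) → Matrix (suc n)
    B u v = A [ k ≔ u ] [ l ≔ v ]
    B-k : ∀ u v r → B u v r k ≈ u r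
    B-k u v r = ≈-trans (≔-there (A [ k ≔ u ]) l v r k≢l) (≔-here A k u r refl)
    B-l : ∀ u v r → B u v r l ≈ v r
    B-l u v r = ≔-here (A [ k ≔ u ]) l v r refl
    B-off : ∀ u v r {s} → s ≢ k → s ≢ l → B u v r s ≈ A r s
    B-off u v r s≢k s≢l = ≈-trans (≔-there (A [ k ≔ u ]) l v r s≢l) (≔-there A k u r s≢k)
    A≈ : ∀ r s → A r s ≈ B x y r s
    A≈ r s with s Fin.≟ l
    ... | yes refl = ≈-refl
    ... | no  _ with s Fin.≟ k
    ...   | yes refl = ≈-refl
    ...   | no _ = ≈-refl
    add₂ : ∀ u → det (B u z) ≈ det (B u x) + det (B u y)
    add₂ u = ≈-trans (det-add (A [ k ≔ u ]) l x y 1#) (+-congˡ (*-identityˡ _))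
    B-cong : ∀ u u′ v r s → s ≢ k → B u v r s ≈ B u′ v r s
    B-cong u u′ v r s s≢k with s Fin.≟ l
    ... | yes _ = ≈-refl
    ... | no  _ = ≈-trans (≔-there A k u r s≢k) (≈-sym (≔-there A k u′ r s≢k))
    add₁ : ∀ v → det (B z v) ≈ det (B x v) + det (B y v)
    add₁ v = ≈-trans
      (det-linear k {B z v} {B x v} {B y v} {1#} (λ r s ≢ → B-cong z x v r s ≢) (λ r s ≢ → B-cong z y v r s ≢)
        λ r → ≈-trans (B-k z v r) (≈-sym (+-cong (B-k x v r) (*-congˡ (B-k y v r)))))
      (+-congˡ (*-identityˡ _))
    xx≈0 : det (B x x) ≈ 0#
    xx≈0 = det-adjacent j (B x x) λ r → ≈-trans (B-k x x r) (≈-sym (B-l x x r))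
    yy≈0 : det (B y y) ≈ 0#
    yy≈0 = det-adjacent j (B y y) λ r → ≈-trans (B-k y y r) (≈-sym (B-l y y r))
    yx≈0 : det (B y x) ≈ 0#
    yx≈0 = det-repeated-gap d (B y x) gap′ λ r → ≈-trans (B-off y x r i≢k i≢l) (≈-trans (e r) (≈-sym (B-k y x r)))

  det-repeated : ∀ {n} {i j : Fin n} (A : Matrix n) → i ≢ j → (∀ r → A r i ≈ A r j) → det A ≈ 0#
  det-repeated {i = i} {j} A i≢j e with ℕ.<-cmp (toℕ i) (toℕ j)
  ... | tri≈ _ eq _ = ⊥-elim (i≢j (Fin.toℕ-injective eq))
  ... | tri< i<j _ _ = det-repeated-gap _ A (≡.trans (≡.sym (ℕ.m∸n+n≡m i<j)) (ℕ.+-suc _ _)) e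
  ... | tri> _ _ j<i = det-repeated-gap _ A (≡.trans (≡.sym (ℕ.m∸n+n≡m j<i)) (ℕ.+-suc _ _)) (≈-sym ∘ e)

  infixr 8 _∙_
  _∙_ : ∀ {l n} → (Fin l → Fin n → Carrier) → (Fin n → Carrier) → Fin l → Carrier
  (A ∙ w) r = ∑ λ j → A r j * w j

  -- Cramer's rule without division: `A ∙ w` combines the columns of `A` with coefficients `w`, and
  -- by linearity only the summand of column `c` survives, since every other one repeats a column.
  cramer : ∀ {n} (A : Matrix n) w c → w c * det A ≈ det (A [ c ≔ A ∙ w ])
  cramer A w c = ≈-sym (begin
    det (A [ c ≔ A ∙ w ])                               ≈⟨ det-cong comm ⟩
    det (A [ c ≔ (λ r → ∑ λ j → w j * A r j) ])         ≈⟨ det-combination A c (λ j r → A r j) w ⟩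
    ∑ (λ j → w j * det (A [ c ≔ (λ r → A r j) ]))       ≈⟨ ∑-single c _ (λ j j≢c → ≈-trans (*-congˡ (det-repeated _ j≢c λ r → ≈-trans (≔-there A c _ r j≢c) (≈-sym (≔-here A c _ r refl)))) (zeroʳ _)) ⟩
    w c * det (A [ c ≔ (λ r → A r c) ])                 ≈⟨ *-congˡ (det-cong same) ⟩
    w c * det A                                         ∎)
    where
    comm : ∀ r s → (A [ c ≔ A ∙ w ]) r s ≈ (A [ c ≔ (λ r → ∑ λ j → w j * A r j) ]) r s
    comm r s with s Fin.≟ c
    ... | yes _ = sum-cong-≋ λ j → *-comm (A r j) (w j)
    ... | no  _ = ≈-refl
    same : ∀ r s → (A [ c ≔ (λ r → A r c) ]) r s ≈ A r s
    same r s with s Fin.≟ c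
    ... | yes refl = ≈-refl
    ... | no  _ = ≈-refl

  -- Every minor other than the one at `c` keeps a zero column. In `det≈0⇒kernel` this turns
  -- Cramer's rule into a statement about that one minor.
  det-first-row : ∀ {n} (A : Matrix (suc n)) c u → (∀ r → u (suc r) ≈ 0#) →
    det (A [ c ≔ u ]) ≈ (- 1#) ^ toℕ c * (u zero * det (minor A c))
  det-first-row {n} A c u e = ≈-trans
    (∑-single c (term (A [ c ≔ u ])) λ j j≢c → term-zero (A [ c ≔ u ]) j (inj₂ (det-zero-column (punchOut j≢c) (minor (A [ c ≔ u ]) j)
      λ r → ≈-trans (≔-here A c u (suc r) (Fin.punchIn-punchOut j≢c)) (e r))))
    (*-congˡ (*-cong (≔-here A c u zero refl) (det-cong λ r s → ≔-there A c u (suc r) (Fin.punchInᵢ≢i c s))))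

-- Linear algebra over the field: kernels and singular matrices

module LinearAlgebra {q : ℕ} (F : FiniteField q c ℓ) where

  open FiniteField F
  open DeterminantProperties commutativeRing
  open Exp semiring using (_^_)
  open SemiringSum semiring renaming (sum to ∑)
  open RingProperties ring using (-‿distribˡ-*; -0#≈0#; -‿involutive)
  open import Relation.Binary.Reasoning.Setoid setoid

  *-cancel-≉0 : ∀ {x y} → ¬ x ≈ 0# → x * y ≈ 0# → y ≈ 0#
  *-cancel-≉0 {x} {y} x≉0 xy≈0 with inverse x x≉0
  ... | x⁻¹ , e = begin
    y               ≈⟨ ≈-sym (*-identityˡ y) ⟩
    1# * y          ≈⟨ *-congʳ (≈-trans (≈-sym e) (*-comm x x⁻¹)) ⟩
    x⁻¹ * x * y     ≈⟨ *-assoc x⁻¹ x y ⟩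
    x⁻¹ * (x * y)   ≈⟨ *-congˡ xy≈0 ⟩
    x⁻¹ * 0#        ≈⟨ zeroʳ x⁻¹ ⟩
    0#              ∎

  [-1]^≉0 : ∀ n → ¬ (- 1#) ^ n ≈ 0#
  [-1]^≉0 zero    e = 1≉0 e
  [-1]^≉0 (suc n) e = [-1]^≉0 n (*-cancel-≉0 (λ e′ → 1≉0 (≈-trans (≈-sym (-‿involutive 1#)) (≈-trans (-‿cong e′) -0#≈0#))) e)

  -- The last component, a zero coefficient for a vanishing `y`, lets `advance` leave certain
  -- vectors unchanged.
  eliminate : ∀ {a} → ¬ a ≈ 0# → ∀ y → ∃ λ α → y + α * a ≈ 0# × (y ≈ 0# → α ≈ 0#)
  eliminate {a} a≉0 y with inverse a a≉0
  ... | a⁻¹ , e = - (y * a⁻¹) , cancels , λ y≈0 → ≈-trans (-‿cong (≈-trans (*-congʳ y≈0) (zeroˡ _))) -0#≈0#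
    where
    cancels : y + - (y * a⁻¹) * a ≈ 0#
    cancels = begin
      y + - (y * a⁻¹) * a    ≈⟨ +-congˡ (≈-sym (-‿distribˡ-* _ a)) ⟩
      y + - (y * a⁻¹ * a)    ≈⟨ +-congˡ (-‿cong (≈-trans (*-assoc y a⁻¹ a) (≈-trans (*-congˡ (≈-trans (*-comm a⁻¹ a) e)) (*-identityʳ y)))) ⟩
      y + - y                ≈⟨ -‿inverseʳ y ⟩
      0#                     ∎

  ∑-insertAt : ∀ {n} (a : Fin (suc n) → Carrier) u j x →
    ∑ (λ i → a i * insertAt u j x i) ≈ a j * x + ∑ (λ s → a (punchIn j s) * u s)
  ∑-insertAt a u j x = ≈-trans (sum-remove {i = j} (λ i → a i * insertAt u j x i))
    (+-cong (*-congˡ (reflexive (Vector.insertAt-lookup u j x)))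
      (sum-cong-≋ λ s → *-congˡ {x = a (punchIn j s)} (reflexive (Vector.insertAt-punchIn u j x s))))

  ∑-add-scaled : ∀ {n} (a u v : Fin n → Carrier) α →
    ∑ (λ i → a i * (u i + α * v i)) ≈ ∑ (λ i → a i * u i) + α * ∑ (λ i → a i * v i)
  ∑-add-scaled a u v α = begin
    ∑ (λ i → a i * (u i + α * v i))                 ≈⟨ sum-cong-≋ (λ i → ≈-trans (distribˡ (a i) (u i) _) (+-congˡ (swap (a i) (v i)))) ⟩
    ∑ (λ i → a i * u i + α * (a i * v i))           ≈⟨ ∑-distrib-+ (λ i → a i * u i) (λ i → α * (a i * v i)) ⟩
    ∑ (λ i → a i * u i) + ∑ (λ i → α * (a i * v i)) ≈⟨ +-congˡ (≈-sym (*-distribˡ-sum α λ i → a i * v i)) ⟩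
    ∑ (λ i → a i * u i) + α * ∑ (λ i → a i * v i)   ∎
    where
    swap : ∀ x y → x * (α * y) ≈ α * (x * y)
    swap x y = ≈-trans (≈-sym (*-assoc x α y)) (≈-trans (*-congʳ (*-comm x α)) (*-assoc α x y))

  NonzeroVector : ∀ {n} → (Fin n → Carrier) → Set ℓ
  NonzeroVector u = ∃ λ i → ¬ u i ≈ 0#

  -- Gaussian elimination: if the first row vanishes, the first column is set aside with coordinate
  -- 0; otherwise a pivot in column `j` clears the first row by column operations, which the
  -- coordinate `x` at `j` translates back.
  underdetermined : ∀ n (M : Fin n → Fin (suc n) → Carrier) →
    ∃ λ u → NonzeroVector u × ∀ r → (M ∙ u) r ≈ 0#
  underdetermined zero    M = (λ _ → 1#) , (zero , 1≉0) , λ ()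
  underdetermined (suc n) M with Fin.any? (λ j → ¬? (M zero j ≟ 0#))
  ... | no none with underdetermined n (λ r j → M (suc r) (suc j))
  ...   | u , (i , u≉0) , e = insertAt u zero 0# , (suc i , u≉0) , λ
          { zero    → ∑-zero _ λ j → ≈-trans (*-congʳ (decidable-stable (M zero j ≟ 0#) λ ≉ → none (j , ≉))) (zeroˡ (insertAt u zero 0# j))
          ; (suc r) → ≈-trans (+-congʳ (zeroʳ _)) (≈-trans (+-identityˡ _) (e r)) }
  underdetermined (suc n) M | yes (j , a≉0) with underdetermined n (λ r s → M (suc r) (punchIn j s) + proj₁ (eliminate a≉0 (M zero (punchIn j s))) * M (suc r) j)
  ... | u , (i , u≉0) , e = insertAt u j x , (punchIn j i , λ z → u≉0 (≈-trans (reflexive (≡.sym (Vector.insertAt-punchIn u j x i))) z)) , λ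
          { zero    → ≈-trans (row zero) (∑-zero _ λ s → ≈-trans (*-congʳ (proj₁ (proj₂ (eliminate a≉0 (M zero (punchIn j s)))))) (zeroˡ (u s)))
          ; (suc r) → ≈-trans (row (suc r)) (e r) }
    where
    α : Fin (suc n) → Carrier
    α s = proj₁ (eliminate a≉0 (M zero (punchIn j s)))
    x : Carrier
    x = ∑ λ s → α s * u s
    row : ∀ r → (M ∙ insertAt u j x) r ≈ ∑ λ s → (M r (punchIn j s) + α s * M r j) * u s
    row r = begin
      (M ∙ insertAt u j x) r                                              ≈⟨ ∑-insertAt (M r) u j x ⟩
      M r j * x + ∑ (λ s → M r (punchIn j s) * u s)                       ≈⟨ +-comm _ _ ⟩
      ∑ (λ s → M r (punchIn j s) * u s) + M r j * x                       ≈⟨ +-congˡ (*-distribˡ-sum (M r j) λ s → α s * u s) ⟩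
      ∑ (λ s → M r (punchIn j s) * u s) + ∑ (λ s → M r j * (α s * u s))   ≈⟨ ≈-sym (∑-distrib-+ (λ s → M r (punchIn j s) * u s) (λ s → M r j * (α s * u s))) ⟩
      ∑ (λ s → M r (punchIn j s) * u s + M r j * (α s * u s))             ≈⟨ sum-cong-≋ (λ s → ≈-trans
          (+-congˡ (≈-trans (≈-sym (*-assoc _ _ _)) (*-congʳ (*-comm (M r j) (α s))))) (≈-sym (distribʳ (u s) (M r (punchIn j s)) (α s * M r j)))) ⟩
      ∑ (λ s → (M r (punchIn j s) + α s * M r j) * u s)                   ∎

  kernel⇒det≈0 : ∀ {n} (A : Matrix n) w → NonzeroVector w → (∀ r → (A ∙ w) r ≈ 0#) → det A ≈ 0#
  kernel⇒det≈0 A w (i , w≉0) e = *-cancel-≉0 w≉0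
    (≈-trans (cramer A w i) (det-zero-column i _ λ r → ≈-trans (≔-here A i _ r refl) (e r)))

  -- The rows after the first kill some nonzero `w`. If the first row does not, Cramer's rule at a
  -- coordinate `i` where `w` is nonzero shows that the minor at `i` is singular. Its kernel vector,
  -- padded with 0 at `i` and corrected by a multiple of `w`, is killed by all rows.
  det≈0⇒kernel : ∀ {n} (A : Matrix n) → det A ≈ 0# → ∃ λ w → NonzeroVector w × ∀ r → (A ∙ w) r ≈ 0#
  det≈0⇒kernel {zero}  A e = ⊥-elim (1≉0 e)
  det≈0⇒kernel {suc n} A e with underdetermined n (A ∘ suc)
  ... | w , (i , w≉0) , Bw≈0 with (A ∙ w) zero ≟ 0#
  ...   | yes z = w , (i , w≉0) , λ { zero → z ; (suc r) → Bw≈0 r }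
  ...   | no  nz with det≈0⇒kernel (minor A i) (*-cancel-≉0 nz (*-cancel-≉0 ([-1]^≉0 (toℕ i))
                      (≈-trans (≈-sym (det-first-row A i (A ∙ w) Bw≈0)) (≈-trans (≈-sym (cramer A w i)) (≈-trans (*-congˡ e) (zeroʳ _))))))
  ...     | v , (l , v≉0) , ev = w′ , nonzero , λ
            { zero    → ≈-trans (split zero) kills
            ; (suc r) → ≈-trans (split (suc r)) (≈-trans (+-cong (≈-trans (lifted (suc r)) (ev r)) (≈-trans (*-congˡ (Bw≈0 r)) (zeroʳ _))) (+-identityˡ 0#)) }
    where
    v′ : Fin (suc n) → Carrier
    v′ = insertAt v i 0#
    lifted : ∀ r → (A ∙ v′) r ≈ ∑ λ s → A r (punchIn i s) * v s
    lifted r = ≈-trans (∑-insertAt (A r) v i 0#) (≈-trans (+-congʳ (zeroʳ _)) (+-identityˡ _))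
    α : Carrier
    α = proj₁ (eliminate nz ((A ∙ v′) zero))
    kills : (A ∙ v′) zero + α * (A ∙ w) zero ≈ 0#
    kills = proj₁ (proj₂ (eliminate nz ((A ∙ v′) zero)))
    w′ : Fin (suc n) → Carrier
    w′ j = v′ j + α * w j
    split : ∀ r → (A ∙ w′) r ≈ (A ∙ v′) r + α * (A ∙ w) r
    split r = ∑-add-scaled (A r) v′ w α
    nonzero : NonzeroVector w′
    nonzero with α ≟ 0#
    ... | yes α≈0 = punchIn i l , λ z → v≉0 (begin
          v l                             ≈⟨ reflexive (≡.sym (Vector.insertAt-punchIn v i 0# l)) ⟩
          v′ (punchIn i l)                ≈⟨ ≈-sym (+-identityʳ _) ⟩
          v′ (punchIn i l) + 0#           ≈⟨ +-congˡ (≈-sym (≈-trans (*-congʳ α≈0) (zeroˡ _))) ⟩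
          w′ (punchIn i l)                ≈⟨ z ⟩
          0#                              ∎)
    ... | no α≉0 = i , λ z → w≉0 (*-cancel-≉0 α≉0 (begin
          α * w i              ≈⟨ ≈-sym (+-identityˡ _) ⟩
          0# + α * w i         ≈⟨ +-congʳ (reflexive (≡.sym (Vector.insertAt-lookup v i 0#))) ⟩
          w′ i                 ≈⟨ z ⟩
          0#                   ∎))

-- Iverson brackets and finite sums of natural numbers

module ℕ∑ = SemiringSum ℕ.+-*-semiring

⟦_⟧ : {A : Set c} → Dec A → ℕ
⟦ yes _ ⟧ = 1
⟦ no  _ ⟧ = 0

⟦⟧-yes : {A : Set c} (d : Dec A) → A → ⟦ d ⟧ ≡ 1
⟦⟧-yes (yes _) _ = refl
⟦⟧-yes (no ¬x) x = ⊥-elim (¬x x)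

⟦⟧-no : {A : Set c} (d : Dec A) → ¬ A → ⟦ d ⟧ ≡ 0
⟦⟧-no (yes x) ¬x = ⊥-elim (¬x x)
⟦⟧-no (no _)  _  = refl

⟦⟧-cong : {A : Set c} {B : Set ℓ} (d : Dec A) (d′ : Dec B) → (A → B) → (B → A) → ⟦ d ⟧ ≡ ⟦ d′ ⟧
⟦⟧-cong d (yes y) _ g = ⟦⟧-yes d (g y)
⟦⟧-cong d (no ¬y) f _ = ⟦⟧-no d (¬y ∘ f)

⟦⟧-× : {A : Set c} {B : Set ℓ} (d : Dec A) (d′ : Dec B) → ⟦ d ×-dec d′ ⟧ ≡ ⟦ d ⟧ ℕ.* ⟦ d′ ⟧
⟦⟧-× (yes _) (yes _) = refl
⟦⟧-× (yes _) (no _)  = refl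
⟦⟧-× (no _)  _       = refl

∑ℕ-zero : ∀ {n} (f : Fin n → ℕ) → (∀ i → f i ≡ 0) → ℕ∑.sum f ≡ 0
∑ℕ-zero {n} f e = ≡.trans (ℕ∑.sum-cong-≗ e) (ℕ∑.sum-replicate-zero n)

∑ℕ-zero⁻ : ∀ {n} (f : Fin n → ℕ) → ℕ∑.sum f ≡ 0 → ∀ i → f i ≡ 0
∑ℕ-zero⁻ f e zero    = ℕ.m+n≡0⇒m≡0 (f zero) e
∑ℕ-zero⁻ f e (suc i) = ∑ℕ-zero⁻ (f ∘ suc) (ℕ.m+n≡0⇒n≡0 (f zero) e) i

∑ℕ-single : ∀ {n} (i : Fin n) (f : Fin n → ℕ) → (∀ j → j ≢ i → f j ≡ 0) → ℕ∑.sum f ≡ f i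
∑ℕ-single {suc n} i f e = ≡.trans (ℕ∑.sum-remove {i = i} f)
  (≡.trans (≡.cong (f i ℕ.+_) (∑ℕ-zero _ λ j → e _ (Fin.punchInᵢ≢i i j))) (ℕ.+-identityʳ _))

∑ℕ-const : ∀ n x → ℕ∑.sum {n} (λ _ → x) ≡ n ℕ.* x
∑ℕ-const zero    x = refl
∑ℕ-const (suc n) x = ≡.cong (x ℕ.+_) (∑ℕ-const n x)

-- Counting over values read into a stream

module Streams {q : ℕ} (F : FiniteField q c ℓ) where

  open FiniteField F
  open Probability F using (_◁_) public
  open DeterminantProperties commutativeRing using (∑-zero; ∑-single)
  open SemiringSum semiring renaming (sum to ∑)

  Stream : Set c
  Stream = ℕ → Carrier

  -- The sequence … 0, 0, h₀ = 1, newest value first.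
  h₀ : Stream
  h₀ = 1# ◁ λ _ → 0#

  -- Divided by `q ^ N`, this is the conditional expectation of `φ` given the past `h` when `N`
  -- independent uniform values are read; the factor is kept so that counts stay in ℕ.
  total : ℕ → (Stream → ℕ) → Stream → ℕ
  total zero    φ h = φ h
  total (suc N) φ h = ℕ∑.sum λ i → total N φ (element i ◁ h)

  total-+ : ∀ m N φ h → total (m ℕ.+ N) φ h ≡ total m (total N φ) h
  total-+ zero    N φ h = refl
  total-+ (suc m) N φ h = ℕ∑.sum-cong-≗ λ i → total-+ m N φ (element i ◁ h)

  -- Streams are functions, so the present is related to its past pointwise; the fresh values occupy
  -- the positions below `m`.
  Extends : ℕ → Stream → Stream → Set c
  Extends m h h′ = ∀ t → h′ (m ℕ.+ t) ≡ h t

  extends-suc : ∀ m x h h′ → Extends m (x ◁ h) h′ → Extends (suc m) h h′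
  extends-suc m x h h′ e t = ≡.trans (≡.cong h′ (≡.sym (ℕ.+-suc m t))) (e (suc t))

  total-cong : ∀ m {φ ψ h} → (∀ h′ → Extends m h h′ → φ h′ ≡ ψ h′) → total m φ h ≡ total m ψ h
  total-cong zero    e = e _ λ _ → refl
  total-cong (suc m) e = ℕ∑.sum-cong-≗ λ i → total-cong m λ h′ → e h′ ∘ extends-suc m (element i) _ h′

  -- A coupling: the same fresh values are read after two different pasts. It serves to replace one
  -- value of the past by 0.
  total-couple : ∀ m {φ ψ g h} →
    (∀ g′ h′ → (∀ t → t ℕ.< m → g′ t ≡ h′ t) → Extends m g g′ → Extends m h h′ → φ g′ ≡ ψ h′) →
    total m φ g ≡ total m ψ h
  total-couple zero    e = e _ _ (λ _ ()) (λ _ → refl) (λ _ → refl)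
  total-couple (suc m) e = ℕ∑.sum-cong-≗ λ i → total-couple m λ g′ h′ same eg eh →
    e g′ h′ (agree i same eg eh) (extends-suc m (element i) _ g′ eg) (extends-suc m (element i) _ h′ eh)
    where
    agree : ∀ i {g h g′ h′} → (∀ t → t ℕ.< m → g′ t ≡ h′ t) → Extends m (element i ◁ g) g′ →
      Extends m (element i ◁ h) h′ → ∀ t → t ℕ.< suc m → g′ t ≡ h′ t
    agree i {g′ = g′} {h′} same eg eh t (s≤s t≤m) with ℕ.m≤n⇒m<n∨m≡n t≤m
    ... | inj₁ t<m = same t t<m
    ... | inj₂ refl = ≡.trans (≡.cong g′ (≡.sym (ℕ.+-identityʳ t)))
            (≡.trans (≡.trans (eg 0) (≡.sym (eh 0))) (≡.cong h′ (ℕ.+-identityʳ t)))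

  total-∑ : ∀ m {n} (ψ : Fin n → Stream → ℕ) h →
    ℕ∑.sum (λ i → total m (ψ i) h) ≡ total m (λ g → ℕ∑.sum λ i → ψ i g) h
  total-∑ zero    ψ h = refl
  total-∑ (suc m) ψ h = ≡.trans (ℕ∑.∑-comm λ i j → total m (ψ i) (element j ◁ h))
    (ℕ∑.sum-cong-≗ λ j → total-∑ m ψ (element j ◁ h))

  total-add : ∀ m φ ψ h → total m (λ g → φ g ℕ.+ ψ g) h ≡ total m φ h ℕ.+ total m ψ h
  total-add zero    φ ψ h = refl
  total-add (suc m) φ ψ h = ≡.trans (ℕ∑.sum-cong-≗ λ i → total-add m φ ψ (element i ◁ h))
    (ℕ∑.∑-distrib-+ (λ i → total m φ (element i ◁ h)) λ i → total m ψ (element i ◁ h))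

  total-scale : ∀ m φ x h → total m (λ g → φ g ℕ.* x) h ≡ total m φ h ℕ.* x
  total-scale zero    φ x h = refl
  total-scale (suc m) φ x h = ≡.trans (ℕ∑.sum-cong-≗ λ i → total-scale m φ x (element i ◁ h))
    (≡.sym (ℕ∑.*-distribʳ-sum x λ i → total m φ (element i ◁ h)))

  total-const : ∀ m x h → total m (λ _ → x) h ≡ q ℕ.^ m ℕ.* x
  total-const zero    x h = ≡.sym (ℕ.*-identityˡ x)
  total-const (suc m) x h = ≡.trans (ℕ∑.sum-cong-≗ λ i → total-const m x (element i ◁ h))
    (≡.trans (∑ℕ-const q _) (≡.sym (ℕ.*-assoc q (q ℕ.^ m) x)))

  element-injective : ∀ {i j} → element i ≈ element j → i ≡ j
  element-injective e = ≡.trans (≡.sym (strictlyInverseʳ _)) (≡.trans (index-cong e) (strictlyInverseʳ _))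
    where open Inverse enumeration using (strictlyInverseʳ)

  unique-root : ∀ y → ℕ∑.sum (λ i → ⟦ element i + y ≟ 0# ⟧) ≡ 1
  unique-root y = ≡.trans
    (∑ℕ-single (index (- y)) _ λ j j≢ → ⟦⟧-no (element j + y ≟ 0#) λ e → j≢ (element-injective (≈-trans
      (+-inverseˡ-unique (element j) y e) (≈-sym (element-index (- y))))))
    (⟦⟧-yes (element (index (- y)) + y ≟ 0#) (≈-trans (+-congʳ (element-index (- y))) (-‿inverseˡ y)))
    where open RingProperties ring using (+-inverseˡ-unique)

  range : ℕ → (ℕ → Carrier) → Carrier
  range n g = ∑ {n} (g ∘ toℕ)

  range-cong : ∀ n {g g′} → (∀ t → t ℕ.< n → g t ≈ g′ t) → range n g ≈ range n g′
  range-cong n e = sum-cong-≋ λ i → e (toℕ i) (Fin.toℕ<n i)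

  range-zero : ∀ n g → (∀ t → t ℕ.< n → g t ≈ 0#) → range n g ≈ 0#
  range-zero n g e = ∑-zero _ λ i → e (toℕ i) (Fin.toℕ<n i)

  range-+ : ∀ m n g → range (m ℕ.+ n) g ≈ range m g + range n (λ t → g (m ℕ.+ t))
  range-+ zero    n g = ≈-sym (+-identityˡ _)
  range-+ (suc m) n g = ≈-trans (+-congˡ (range-+ m n (g ∘ suc))) (≈-sym (+-assoc _ _ _))

  -- Dual families and the probability that a window annihilates them

  module Pairing (k : ℕ) where

    ⟨_,_⟩ : Stream → Stream → Carrier
    ⟨ h , w ⟩ = range k λ t → h t * w t

    pair-congˡ : ∀ {g h} w → (∀ t → g t ≡ h t) → ⟨ g , w ⟩ ≈ ⟨ h , w ⟩
    pair-congˡ w e = range-cong k λ t _ → *-congʳ {w t} (reflexive (e t))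

    pair-change : ∀ m {g h} w → m ℕ.< k → (∀ t → t ≢ m → g t ≡ h t) → h m ≡ 0# →
      ⟨ g , w ⟩ ≈ g m * w m + ⟨ h , w ⟩
    pair-change m {g} {h} w m<k same hm≡0 = begin
      ⟨ g , w ⟩                                          ≈⟨ range-cong k (λ t _ → each t) ⟩
      range k (λ t → d t + h t * w t)                    ≈⟨ ∑-distrib-+ {k} (d ∘ toℕ) (λ t → h (toℕ t) * w (toℕ t)) ⟩
      range k d + ⟨ h , w ⟩                              ≈⟨ +-congʳ (≈-trans (∑-single (fromℕ< m<k) (d ∘ toℕ) λ j j≢ → d-no (λ e → j≢ (Fin.toℕ-injective (≡.trans e (≡.sym (Fin.toℕ-fromℕ< m<k)))))) (d-yes (Fin.toℕ-fromℕ< m<k))) ⟩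
      g m * w m + ⟨ h , w ⟩                              ∎
      where
      open import Relation.Binary.Reasoning.Setoid setoid
      d : ℕ → Carrier
      d t with t ℕ.≟ m
      ... | yes _ = g m * w m
      ... | no  _ = 0#
      d-no : ∀ {t} → t ≢ m → d t ≈ 0#
      d-no {t} t≢m with t ℕ.≟ m
      ... | yes e = ⊥-elim (t≢m e)
      ... | no  _ = ≈-refl
      d-yes : ∀ {t} → t ≡ m → d t ≈ g m * w m
      d-yes {t} e with t ℕ.≟ m
      ... | yes _ = ≈-refl
      ... | no t≢m = ⊥-elim (t≢m e)
      each : ∀ t → g t * w t ≈ d t + h t * w t
      each t with t ℕ.≟ m
      ... | yes refl = ≈-sym (≈-trans (+-congˡ (≈-trans (*-congʳ (reflexive hm≡0)) (zeroˡ _))) (+-identityʳ _))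
      ... | no t≢m   = ≈-sym (≈-trans (+-identityˡ _) (*-congʳ (reflexive (≡.sym (same t t≢m)))))

    -- A reduced echelon form with its pivots in no particular order: on the pivot coordinates the
    -- vectors form an identity matrix, and hence they are independent.
    record DualFamily (e : ℕ) : Set (c Level.⊔ ℓ) where
      field
        vector     : Fin e → Stream
        pivot      : Fin e → ℕ
        pivot<k    : ∀ i → pivot i ℕ.< k
        diagonal   : ∀ i → vector i (pivot i) ≈ 1#
        off-diagonal : ∀ i j → i ≢ j → vector i (pivot j) ≈ 0#

      pivot-injective : ∀ {i j} → pivot i ≡ pivot j → i ≡ j
      pivot-injective {i} {j} eq with i Fin.≟ j
      ... | yes i≡j = i≡j
      ... | no i≢j  = ⊥-elim (1≉0 (≈-trans (≈-sym (diagonal i)) (≈-trans (reflexive (≡.cong (vector i) eq)) (off-diagonal i j i≢j))))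

      -- In a `Basis`, whose field `low` makes the vectors with later pivots vanish on the first `m`
      -- places, the value at `m` is the rank of the orthogonal space on these places.
      rank : ℕ → ℕ
      rank m = ℕ∑.sum λ i → ⟦ pivot i ℕ.<? m ⟧

      Annihilates : ℕ → Stream → Set ℓ
      Annihilates m h = ∀ i → pivot i ℕ.< m → ⟨ h , vector i ⟩ ≈ 0#

      annihilates? : ∀ m h → Dec (Annihilates m h)
      annihilates? m h = Fin.all? λ i → (pivot i ℕ.<? m) →-dec (⟨ h , vector i ⟩ ≟ 0#)

      rank-suc-none : ∀ {m} → ¬ (∃ λ i → pivot i ≡ m) → rank (suc m) ≡ rank m
      rank-suc-none {m} none = ℕ∑.sum-cong-≗ λ i → ⟦⟧-cong (pivot i ℕ.<? suc m) (pivot i ℕ.<? m)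
        (λ p< → ℕ.≤∧≢⇒< (ℕ.s≤s⁻¹ p<) λ eq → none (i , eq)) ℕ.m≤n⇒m≤1+n

      rank-suc-pivot : ∀ {m} i → pivot i ≡ m → rank (suc m) ≡ suc (rank m)
      rank-suc-pivot i refl = ≡.trans (ℕ∑.sum-cong-≗ each) (≡.trans
        (ℕ∑.∑-distrib-+ (λ j → ⟦ j Fin.≟ i ⟧) (λ j → ⟦ pivot j ℕ.<? pivot i ⟧))
        (≡.cong (ℕ._+ rank (pivot i)) (≡.trans (∑ℕ-single i _ λ j j≢i → ⟦⟧-no (j Fin.≟ i) j≢i) (⟦⟧-yes (i Fin.≟ i) refl))))
        where
        each : ∀ j → ⟦ pivot j ℕ.<? suc (pivot i) ⟧ ≡ ⟦ j Fin.≟ i ⟧ ℕ.+ ⟦ pivot j ℕ.<? pivot i ⟧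
        each j with j Fin.≟ i
        ... | yes refl = ≡.trans (⟦⟧-yes (pivot j ℕ.<? suc (pivot j)) ℕ.≤-refl)
                (≡.cong suc (≡.sym (⟦⟧-no (pivot j ℕ.<? pivot j) (ℕ.<-irrefl refl))))
        ... | no j≢i = ⟦⟧-cong (pivot j ℕ.<? suc (pivot i)) (pivot j ℕ.<? pivot i)
                (λ p< → ℕ.≤∧≢⇒< (ℕ.s≤s⁻¹ p<) (j≢i ∘ pivot-injective)) ℕ.m≤n⇒m≤1+n

      -- The vectors with pivots below `m` impose `rank m` independent conditions. In the induction
      -- step the value read first ends up at position `m`. Without a pivot there it merely joins
      -- the past, which is arbitrary; with a pivot it has coefficient 1 in one product and 0 in all
      -- others, so exactly one of its `q` values meets the extra condition.
      total-annihilates : ∀ m h → total m (λ g → ⟦ annihilates? m g ⟧) h ℕ.* q ℕ.^ rank m ≡ q ℕ.^ m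
      total-annihilates zero h = ≡.cong₂ ℕ._*_ (⟦⟧-yes (annihilates? zero h) λ _ ())
        (≡.cong (q ℕ.^_) (∑ℕ-zero _ λ i → ⟦⟧-no (pivot i ℕ.<? zero) λ ()))
      total-annihilates (suc m) h with Fin.any? (λ i → pivot i ℕ.≟ m)
      ... | no none = ≡.trans (ℕ∑.*-distribʳ-sum (q ℕ.^ rank (suc m)) λ i → total m (λ g → ⟦ annihilates? (suc m) g ⟧) (element i ◁ h))
              (≡.trans (ℕ∑.sum-cong-≗ λ i → ≡.trans (≡.cong₂ ℕ._*_ (total-cong m λ g _ → drop g) (≡.cong (q ℕ.^_) (rank-suc-none none))) (total-annihilates m (element i ◁ h)))
                (∑ℕ-const q _))
        where
        drop : ∀ g → ⟦ annihilates? (suc m) g ⟧ ≡ ⟦ annihilates? m g ⟧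
        drop g = ⟦⟧-cong (annihilates? (suc m) g) (annihilates? m g) (λ z i p< → z i (ℕ.m≤n⇒m≤1+n p<))
          λ { z i (s≤s p≤m) → z i (ℕ.≤∧≢⇒< p≤m λ eq → none (i , eq)) }
      ... | yes (i₀ , at-m) = begin
          ℕ∑.sum (λ i → total m (λ g → ⟦ annihilates? (suc m) g ⟧) (element i ◁ h)) ℕ.* q ℕ.^ rank (suc m)
            ≡⟨ ≡.cong₂ ℕ._*_ (ℕ∑.sum-cong-≗ λ i → total-couple m (couple i)) (≡.cong (q ℕ.^_) (rank-suc-pivot i₀ at-m)) ⟩
          ℕ∑.sum (λ i → total m (ψ i) (0# ◁ h)) ℕ.* (q ℕ.* q ℕ.^ rank m)
            ≡⟨ ≡.cong (ℕ._* (q ℕ.* q ℕ.^ rank m)) (≡.trans (total-∑ m ψ (0# ◁ h)) (total-cong m λ g _ → collapse g)) ⟩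
          A ℕ.* (q ℕ.* q ℕ.^ rank m)     ≡⟨ ≡.sym (ℕ.*-assoc A q (q ℕ.^ rank m)) ⟩
          A ℕ.* q ℕ.* q ℕ.^ rank m       ≡⟨ ≡.cong (ℕ._* q ℕ.^ rank m) (ℕ.*-comm A q) ⟩
          q ℕ.* A ℕ.* q ℕ.^ rank m       ≡⟨ ℕ.*-assoc q A (q ℕ.^ rank m) ⟩
          q ℕ.* (A ℕ.* q ℕ.^ rank m)     ≡⟨ ≡.cong (q ℕ.*_) (total-annihilates m (0# ◁ h)) ⟩
          q ℕ.* q ℕ.^ m                  ∎
        where
        open ≡.≡-Reasoning
        A = total m (λ g → ⟦ annihilates? m g ⟧) (0# ◁ h)
        root? : ∀ i g → Dec (element i + ⟨ g , vector i₀ ⟩ ≈ 0#)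
        root? i g = element i + ⟨ g , vector i₀ ⟩ ≟ 0#
        ψ : Fin q → Stream → ℕ
        ψ i g = ⟦ annihilates? m g ⟧ ℕ.* ⟦ root? i g ⟧
        collapse : ∀ g → ℕ∑.sum (λ i → ψ i g) ≡ ⟦ annihilates? m g ⟧
        collapse g = ≡.trans (≡.sym (ℕ∑.*-distribˡ-sum ⟦ annihilates? m g ⟧ λ i → ⟦ root? i g ⟧))
          (≡.trans (≡.cong (⟦ annihilates? m g ⟧ ℕ.*_) (unique-root ⟨ g , vector i₀ ⟩)) (ℕ.*-identityʳ _))
        -- Once the value at position `m` is replaced by 0, the past no longer depends on `i`, and
        -- the sum over `i` can be moved inside.
        couple : ∀ i g g′ → (∀ t → t ℕ.< m → g t ≡ g′ t) → Extends m (element i ◁ h) g → Extends m (0# ◁ h) g′ →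
          ⟦ annihilates? (suc m) g ⟧ ≡ ψ i g′
        couple i g g′ same eg eg′ = ≡.trans
          (⟦⟧-cong (annihilates? (suc m) g) (annihilates? m g′ ×-dec root? i g′) to from)
          (⟦⟧-× (annihilates? m g′) (root? i g′))
          where
          off : ∀ t → t ≢ m → g t ≡ g′ t
          off t t≢m with t ℕ.<? m
          ... | yes t<m = same t t<m
          ... | no  t≮m = ≡.trans (≡.cong g eq′) (≡.trans (≡.trans (eg (suc o)) (≡.sym (eg′ (suc o)))) (≡.cong g′ (≡.sym eq′)))
            where
            o = t ℕ.∸ suc m
            eq′ : t ≡ m ℕ.+ suc o
            eq′ = ≡.sym (≡.trans (ℕ.+-suc m o) (ℕ.m+[n∸m]≡n (ℕ.≤∧≢⇒< (ℕ.≮⇒≥ t≮m) (t≢m ∘ ≡.sym))))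
          gm : g m ≡ element i
          gm = ≡.trans (≡.cong g (≡.sym (ℕ.+-identityʳ m))) (eg 0)
          g′m : g′ m ≡ 0#
          g′m = ≡.trans (≡.cong g′ (≡.sym (ℕ.+-identityʳ m))) (eg′ 0)
          change : ∀ j → ⟨ g , vector j ⟩ ≈ element i * vector j m + ⟨ g′ , vector j ⟩
          change j = ≈-trans (pair-change m (vector j) (≡.subst (ℕ._< k) at-m (pivot<k i₀)) off g′m) (+-congʳ (*-congʳ (reflexive gm)))
          at-i₀ : ⟨ g , vector i₀ ⟩ ≈ element i + ⟨ g′ , vector i₀ ⟩
          at-i₀ = ≈-trans (change i₀) (+-congʳ (≈-trans (*-congˡ (≈-trans (reflexive (≡.cong (vector i₀) (≡.sym at-m))) (diagonal i₀))) (*-identityʳ _)))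
          away : ∀ j → j ≢ i₀ → ⟨ g , vector j ⟩ ≈ ⟨ g′ , vector j ⟩
          away j j≢ = ≈-trans (change j) (≈-trans (+-congʳ (≈-trans (*-congˡ (≈-trans (reflexive (≡.cong (vector j) (≡.sym at-m))) (off-diagonal j i₀ j≢))) (zeroʳ _))) (+-identityˡ _))
          to : Annihilates (suc m) g → Annihilates m g′ × element i + ⟨ g′ , vector i₀ ⟩ ≈ 0#
          to z = (λ j p< → ≈-trans (≈-sym (away j λ { refl → ℕ.<-irrefl at-m p< })) (z j (ℕ.m≤n⇒m≤1+n p<)))
               , ≈-trans (≈-sym at-i₀) (z i₀ (s≤s (ℕ.≤-reflexive at-m)))
          from : Annihilates m g′ × element i + ⟨ g′ , vector i₀ ⟩ ≈ 0# → Annihilates (suc m) g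
          from (z , r) j (s≤s p≤) with j Fin.≟ i₀
          ... | yes refl = ≈-trans at-i₀ r
          ... | no j≢    = ≈-trans (away j j≢) (z j (ℕ.≤∧≢⇒< p≤ λ eq → j≢ (pivot-injective (≡.trans eq (≡.sym at-m)))))

⟦⟧-¬ : {A : Set c} (d : Dec A) → ⟦ ¬? d ⟧ ℕ.+ ⟦ d ⟧ ≡ 1
⟦⟧-¬ (yes _) = refl
⟦⟧-¬ (no _)  = refl

-- Windows and the space orthogonal to them

module Sliding {q : ℕ} (F : FiniteField q c ℓ) (k m : ℕ) .{{_ : NonZero m}} where

  open FiniteField F
  open DeterminantProperties commutativeRing
  open LinearAlgebra F
  open Streams F
  open Pairing k
  open SemiringSum semiring renaming (sum to ∑)
  open import Relation.Binary.Reasoning.Setoid setoid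

  drop : ℕ → Stream → Stream
  drop i h t = h (i ℕ.+ t)

  -- Streams are read backwards, so row r of the Jacobi–Trudi matrix, read from its right end,
  -- is the window of length k at offset r * m.
  windows : Stream → Matrix k
  windows h r s = h (toℕ r ℕ.* m ℕ.+ toℕ (opposite s))

  nonsingular? : ∀ h → Dec (¬ det (windows h) ≈ 0#)
  nonsingular? h = ¬? (det (windows h) ≟ 0#)

  -- A vector of length `k` is encoded as a stream supported on its first `k` places, so that
  -- shifting it by `m` stays within the same type.
  record Orthogonal (i : ℕ) (h w : Stream) : Set ℓ where
    field
      supported : ∀ t → k ℕ.≤ t → w t ≈ 0#
      rows      : ∀ j → j ℕ.< i → ⟨ drop (j ℕ.* m) h , w ⟩ ≈ 0#

  open Orthogonal

  -- Column `s` of `windows` holds position `opposite s` of each window, so vectors are reversed and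
  -- the sums reindexed.
  kernel⇒singular : ∀ {h w} → Orthogonal k h w → ∀ {t} → ¬ w t ≈ 0# → det (windows h) ≈ 0#
  kernel⇒singular {h} {w} o {t} w≉0 with t ℕ.<? k
  ... | no t≮k  = ⊥-elim (w≉0 (supported o t (ℕ.≮⇒≥ t≮k)))
  ... | yes t<k = kernel⇒det≈0 (windows h) (λ s → w (toℕ (opposite s)))
    (opposite (fromℕ< t<k) , λ e → w≉0 (≈-trans (reflexive (≡.cong w (≡.sym (≡.trans (≡.cong toℕ (Fin.opposite-involutive (fromℕ< t<k))) (Fin.toℕ-fromℕ< t<k))))) e))
    λ r → ≈-trans (≈-sym (sum-permute {k} {k} (λ s → h (toℕ r ℕ.* m ℕ.+ toℕ s) * w (toℕ s)) Permutation.reverse)) (rows o (toℕ r) (Fin.toℕ<n r))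

  singular⇒kernel : ∀ {h} → det (windows h) ≈ 0# → ∃ λ w → Orthogonal k h w × ∃ λ t → ¬ w t ≈ 0#
  singular⇒kernel {h} e with det≈0⇒kernel (windows h) e
  ... | v , (s , v≉0) , ev = w , record { supported = out ; rows = row } , toℕ (opposite s) ,
        λ z → v≉0 (≈-trans (reflexive (≡.cong v (≡.sym (Fin.opposite-involutive s)))) (≈-trans (≈-sym (w-toℕ (opposite s))) z))
    where
    w : Stream
    w t with t ℕ.<? k
    ... | yes t<k = v (opposite (fromℕ< t<k))
    ... | no  _   = 0#
    out : ∀ t → k ℕ.≤ t → w t ≈ 0#
    out t k≤t with t ℕ.<? k
    ... | yes t<k = ⊥-elim (ℕ.<⇒≱ t<k k≤t)
    ... | no  _   = ≈-refl
    w-toℕ : ∀ i → w (toℕ i) ≈ v (opposite i)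
    w-toℕ i with toℕ i ℕ.<? k
    ... | yes i<k = reflexive (≡.cong (v ∘ opposite) (Fin.fromℕ<-toℕ i i<k))
    ... | no  i≮k = ⊥-elim (i≮k (Fin.toℕ<n i))
    row : ∀ j → j ℕ.< k → ⟨ drop (j ℕ.* m) h , w ⟩ ≈ 0#
    row j j<k = begin
      ⟨ drop (j ℕ.* m) h , w ⟩ ≈⟨ sum-cong-≋ (λ t → *-cong (reflexive (≡.cong₂ (λ r u → h (r ℕ.* m ℕ.+ toℕ u)) (≡.sym (Fin.toℕ-fromℕ< j<k)) (≡.sym (Fin.opposite-involutive t)))) (w-toℕ t)) ⟩
      ∑ (λ t → windows h r (opposite t) * v (opposite t)) ≈⟨ ≈-sym (sum-permute (λ s → windows h r s * v s) Permutation.reverse) ⟩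
      (windows h ∙ v) r ≈⟨ ev r ⟩
      0# ∎
      where r = fromℕ< j<k

  pair-add-scaled : ∀ h u v α → ⟨ h , (λ t → u t + α * v t) ⟩ ≈ ⟨ h , u ⟩ + α * ⟨ h , v ⟩
  pair-add-scaled h u v α = ∑-add-scaled {k} (h ∘ toℕ) (u ∘ toℕ) (v ∘ toℕ) α

  orthogonal-add-scaled : ∀ {i h u v} α → Orthogonal i h u → Orthogonal i h v → Orthogonal i h (λ t → u t + α * v t)
  orthogonal-add-scaled {h = h} {u} {v} α ou ov = record
    { supported = λ t k≤t → zero+zero (supported ou t k≤t) (supported ov t k≤t)
    ; rows      = λ j j<i → ≈-trans (pair-add-scaled (drop (j ℕ.* m) h) u v α) (zero+zero (rows ou j j<i) (rows ov j j<i)) }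
    where
    zero+zero : ∀ {x y} → x ≈ 0# → y ≈ 0# → x + α * y ≈ 0#
    zero+zero x≈0 y≈0 = ≈-trans (+-cong x≈0 (≈-trans (*-congˡ y≈0) (zeroʳ α))) (+-identityˡ 0#)

  module _ {i : ℕ} {h h′ : Stream} (ext : Extends m h h′) where

    -- Reading `m` values turns window `j` into window `j + 1`, so it adds just one orthogonality
    -- condition.
    pair-extends : ∀ j w → ⟨ drop (suc j ℕ.* m) h′ , w ⟩ ≈ ⟨ drop (j ℕ.* m) h , w ⟩
    pair-extends j w = pair-congˡ w λ t → ≡.trans (≡.cong h′ (ℕ.+-assoc m (j ℕ.* m) t)) (ext (j ℕ.* m ℕ.+ t))

    orthogonal-suc : ∀ {w} → Orthogonal i h w → ⟨ h′ , w ⟩ ≈ 0# → Orthogonal (suc i) h′ w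
    orthogonal-suc {w} o e = record { supported = supported o ; rows = λ
      { zero    _         → e
      ; (suc j) (s≤s j<i) → ≈-trans (pair-extends j w) (rows o j j<i) } }

    orthogonal-pred : ∀ {w} → Orthogonal (suc i) h′ w → Orthogonal i h w
    orthogonal-pred {w} o = record { supported = supported o ; rows = λ j j<i →
      ≈-trans (≈-sym (pair-extends j w)) (rows o (suc j) (s≤s j<i)) }

  -- A vector that vanishes on the first `m` places cannot see the fresh values: its product with
  -- the next window is determined by the past.
  pair-drop : ∀ {g w} → (∀ t → t ℕ.< m → w t ≈ 0#) → (∀ t → k ℕ.≤ t → w t ≈ 0#) →
    ⟨ g , w ⟩ ≈ ⟨ drop m g , drop m w ⟩
  pair-drop {g} {w} low high = begin
    range k f                               ≈⟨ ≈-sym (+-identityʳ _) ⟩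
    -- With `m` zero terms added at the far end, `k` terms are left after the first `m` are removed.
    range k f + 0#                          ≈⟨ +-congˡ (≈-sym (range-zero m _ λ t _ → ≈-trans (*-congˡ (high _ (ℕ.m≤m+n k t))) (zeroʳ (g (k ℕ.+ t))))) ⟩
    range k f + range m (λ t → f (k ℕ.+ t)) ≈⟨ ≈-sym (range-+ k m f) ⟩
    range (k ℕ.+ m) f                       ≡⟨ ≡.cong (λ n → range n f) (ℕ.+-comm k m) ⟩
    range (m ℕ.+ k) f                       ≈⟨ range-+ m k f ⟩
    range m f + ⟨ drop m g , drop m w ⟩     ≈⟨ +-congʳ (range-zero m f λ t t<m → ≈-trans (*-congˡ (low t t<m)) (zeroʳ _)) ⟩
    0# + ⟨ drop m g , drop m w ⟩            ≈⟨ +-identityˡ _ ⟩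
    ⟨ drop m g , drop m w ⟩                 ∎
    where
    f : ℕ → Carrier
    f t = g t * w t

  -- `complete` expresses spanning: an orthogonal vector minus the combination with its own pivot
  -- values is zero at all pivots, see `expansion`. `low` is the echelon condition on the places
  -- that the next fresh values will meet.
  record Basis (i : ℕ) (h : Stream) (e : ℕ) : Set (c Level.⊔ ℓ) where
    field
      family     : DualFamily e

    open DualFamily family public

    field
      orthogonal : ∀ l → Orthogonal i h (vector l)
      complete   : ∀ w → Orthogonal i h w → (∀ l → w (pivot l) ≈ 0#) → ∀ t → w t ≈ 0#
      low        : ∀ l → m ℕ.≤ pivot l → ∀ t → t ℕ.< m → vector l t ≈ 0#

    combination : (Fin e → Carrier) → Stream
    combination u t = ∑ λ l → u l * vector l t

    combination-pivot : ∀ u l → combination u (pivot l) ≈ u l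
    combination-pivot u l = ≈-trans (∑-single l _ λ j j≢l → ≈-trans (*-congˡ (off-diagonal j l j≢l)) (zeroʳ _))
      (≈-trans (*-congˡ (diagonal l)) (*-identityʳ _))

    pair-combination : ∀ g s u → ⟨ g , drop s (combination u) ⟩ ≈ ∑ λ l → u l * ⟨ g , drop s (vector l) ⟩
    pair-combination g s u = begin
      ⟨ g , drop s (combination u) ⟩                                      ≈⟨ sum-cong-≋ {k} (λ t → *-distribˡ-sum (g (toℕ t)) λ l → u l * vector l (s ℕ.+ toℕ t)) ⟩
      ∑ {k} (λ t → ∑ λ l → g (toℕ t) * (u l * vector l (s ℕ.+ toℕ t)))    ≈⟨ ∑-comm {k} {e} (λ t l → g (toℕ t) * (u l * vector l (s ℕ.+ toℕ t))) ⟩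
      ∑ (λ l → ∑ {k} λ t → g (toℕ t) * (u l * vector l (s ℕ.+ toℕ t)))    ≈⟨ sum-cong-≋ {e} (λ l → ≈-trans
          (sum-cong-≋ {k} λ t → swap (g (toℕ t)) (u l) (vector l (s ℕ.+ toℕ t))) (≈-sym (*-distribˡ-sum {k} (u l) λ t → g (toℕ t) * vector l (s ℕ.+ toℕ t)))) ⟩
      ∑ (λ l → u l * ⟨ g , drop s (vector l) ⟩)                           ∎
      where
      swap : ∀ x y z → x * (y * z) ≈ y * (x * z)
      swap x y z = ≈-trans (≈-sym (*-assoc x y z)) (≈-trans (*-congʳ (*-comm x y)) (*-assoc y x z))

    orthogonal-combination : ∀ {j g} → (∀ l → Orthogonal j g (vector l)) → ∀ u → Orthogonal j g (combination u)
    orthogonal-combination {g = g} o u = record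
      { supported = λ t k≤t → ∑-zero _ λ l → ≈-trans (*-congˡ (supported (o l) t k≤t)) (zeroʳ (u l))
      ; rows      = λ j j<i → ≈-trans (pair-combination (drop (j ℕ.* m) g) 0 u) (∑-zero _ λ l → ≈-trans (*-congˡ (rows (o l) j j<i)) (zeroʳ (u l))) }

    expansion : ∀ {w} → Orthogonal i h w → ∀ t → w t ≈ combination (w ∘ pivot) t
    expansion {w} o t = begin
      w t                                 ≈⟨ ≈-sym (+-identityʳ _) ⟩
      w t + 0#                            ≈⟨ +-congˡ (≈-sym (-‿inverseˡ _)) ⟩
      w t + (- u t + u t)                 ≈⟨ ≈-sym (+-assoc _ _ _) ⟩
      w t + - u t + u t                   ≈⟨ +-congʳ (+-congˡ (≈-sym (-1*x≈-x _))) ⟩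
      w t + - 1# * u t + u t              ≈⟨ +-congʳ (complete _ (orthogonal-add-scaled (- 1#) o (orthogonal-combination orthogonal (w ∘ pivot))) vanishes t) ⟩
      0# + u t                            ≈⟨ +-identityˡ _ ⟩
      u t                                 ∎
      where
      open RingProperties ring using (-1*x≈-x)
      u = combination (w ∘ pivot)
      vanishes : ∀ l → w (pivot l) + - 1# * u (pivot l) ≈ 0#
      vanishes l = ≈-trans (+-congˡ (≈-trans (-1*x≈-x _) (-‿cong (combination-pivot (w ∘ pivot) l)))) (-‿inverseʳ _)

  module _ {i : ℕ} {h h′ : Stream} {e : ℕ} (B : Basis i h (suc e)) (ext : Extends m h h′) where

    open Basis B

    -- Vector `j` is spent on clearing the products of the others with the new window. It is zero at
    -- their pivots, so duality persists. `tame` preserves `low`: for a vector with a later pivot,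
    -- either vector `j` vanishes on the first `m` places as well or the multiple added is zero.
    advance : ∀ j → ¬ ⟨ h′ , vector j ⟩ ≈ 0# → (∀ l → m ℕ.≤ pivot l → m ℕ.≤ pivot j ⊎ ⟨ h′ , vector l ⟩ ≈ 0#) →
      Basis (suc i) h′ e
    advance j y≉0 tame = record
      { family = record
        { vector       = vector′
        ; pivot        = pivot ∘ punchIn j
        ; pivot<k      = pivot<k ∘ punchIn j
        ; diagonal     = λ s → ≈-trans (off-j s s) (diagonal (punchIn j s))
        ; off-diagonal = λ s t s≢t → ≈-trans (off-j s t) (off-diagonal _ _ (s≢t ∘ Fin.punchIn-injective j s t))
        }
      ; orthogonal = λ s → orthogonal-suc ext (orthogonal-add-scaled (α (punchIn j s)) (orthogonal _) (orthogonal j))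
          (≈-trans (pair-add-scaled h′ (vector (punchIn j s)) (vector j) (α (punchIn j s))) (α-cancels (punchIn j s)))
      ; complete   = complete′
      ; low        = λ s m≤p t t<m → ≈-trans (+-congʳ (low (punchIn j s) m≤p t t<m)) (≈-trans (+-identityˡ _) (correction s m≤p t t<m))
      }
      where
      α : Fin (suc e) → Carrier
      α l = proj₁ (eliminate y≉0 ⟨ h′ , vector l ⟩)
      α-cancels : ∀ l → ⟨ h′ , vector l ⟩ + α l * ⟨ h′ , vector j ⟩ ≈ 0#
      α-cancels l = proj₁ (proj₂ (eliminate y≉0 ⟨ h′ , vector l ⟩))
      vector′ : Fin e → Stream
      vector′ s t = vector (punchIn j s) t + α (punchIn j s) * vector j t
      off-j : ∀ s t → vector′ s (pivot (punchIn j t)) ≈ vector (punchIn j s) (pivot (punchIn j t))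
      off-j s t = ≈-trans (+-congˡ (≈-trans (*-congˡ (off-diagonal j _ (Fin.punchInᵢ≢i j t ∘ ≡.sym))) (zeroʳ _))) (+-identityʳ _)
      correction : ∀ s → m ℕ.≤ pivot (punchIn j s) → ∀ t → t ℕ.< m → α (punchIn j s) * vector j t ≈ 0#
      correction s m≤p t t<m with tame (punchIn j s) m≤p
      ... | inj₁ m≤pj = ≈-trans (*-congˡ (low j m≤pj t t<m)) (zeroʳ _)
      ... | inj₂ y≈0  = ≈-trans (*-congʳ (proj₂ (proj₂ (eliminate y≉0 ⟨ h′ , vector (punchIn j s) ⟩)) y≈0)) (zeroˡ _)
      complete′ : ∀ w → Orthogonal (suc i) h′ w → (∀ s → w (pivot (punchIn j s)) ≈ 0#) → ∀ t → w t ≈ 0#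
      complete′ w o z t = begin
        w t                  ≈⟨ ≈-sym (+-identityʳ _) ⟩
        w t + 0#             ≈⟨ +-congˡ (≈-sym (≈-trans (*-congʳ β≈0) (zeroˡ _))) ⟩
        w t + β * vector j t ≈⟨ w̃≈0 t ⟩
        0#                   ∎
        where
        -- Adding `β` times vector `j` makes `w` zero at all old pivots, hence everywhere. As `w` is
        -- orthogonal to the new window and vector `j` is not, `β` must be zero.
        β = - w (pivot j)
        pivots : ∀ l → w (pivot l) + β * vector j (pivot l) ≈ 0#
        pivots l with j Fin.≟ l
        ... | yes refl = ≈-trans (+-congˡ (≈-trans (*-congˡ (diagonal j)) (*-identityʳ _))) (-‿inverseʳ _)
        ... | no j≢l   = ≈-trans (+-cong (≈-trans (reflexive (≡.cong (w ∘ pivot) (≡.sym (Fin.punchIn-punchOut j≢l)))) (z _))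
                (≈-trans (*-congˡ (off-diagonal j l j≢l)) (zeroʳ _))) (+-identityˡ 0#)
        w̃≈0 : ∀ t → w t + β * vector j t ≈ 0#
        w̃≈0 = complete _ (orthogonal-add-scaled β (orthogonal-pred ext o) (orthogonal j)) pivots
        β≈0 : β ≈ 0#
        β≈0 = *-cancel-≉0 y≉0 (begin
          ⟨ h′ , vector j ⟩ * β                     ≈⟨ *-comm _ _ ⟩
          β * ⟨ h′ , vector j ⟩                     ≈⟨ ≈-sym (+-identityˡ _) ⟩
          0# + β * ⟨ h′ , vector j ⟩                ≈⟨ +-congʳ (≈-sym (rows o 0 ℕ.z<s)) ⟩
          ⟨ h′ , w ⟩ + β * ⟨ h′ , vector j ⟩        ≈⟨ ≈-sym (pair-add-scaled h′ w (vector j) β) ⟩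
          ⟨ h′ , (λ t → w t + β * vector j t) ⟩     ≈⟨ range-zero k _ (λ t _ → ≈-trans (*-congˡ (w̃≈0 t)) (zeroʳ (h′ t))) ⟩
          0#                                        ∎)

    -- With e rows left there are too few equations to kill the e + 1 dimensional orthogonal space.
    doomed : suc i ℕ.+ e ≡ k → (∀ l → ⟨ h′ , vector l ⟩ ≈ 0#) → ∀ g → Extends (e ℕ.* m) h′ g → det (windows g) ≈ 0#
    doomed i+e≡k y≈0 g extg with underdetermined e (λ r l → ⟨ drop (toℕ r ℕ.* m) g , vector l ⟩)
    ... | u , (l , u≉0) , eu = kernel⇒singular {g} {combination u} (record
            { supported = supported (orthogonal-combination orthogonal u)
            ; rows      = row })
            {pivot l} λ z → u≉0 (≈-trans (≈-sym (combination-pivot u l)) z)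
      where
      row : ∀ r → r ℕ.< k → ⟨ drop (r ℕ.* m) g , combination u ⟩ ≈ 0#
      row r r<k with r ℕ.<? e
      ... | yes r<e = begin
        ⟨ drop (r ℕ.* m) g , combination u ⟩                            ≈⟨ pair-combination (drop (r ℕ.* m) g) 0 u ⟩
        ∑ (λ l → u l * ⟨ drop (r ℕ.* m) g , vector l ⟩)                 ≈⟨ sum-cong-≋ (λ l → *-comm (u l) ⟨ drop (r ℕ.* m) g , vector l ⟩) ⟩
        ∑ (λ l → ⟨ drop (r ℕ.* m) g , vector l ⟩ * u l)                 ≡⟨ ≡.cong (λ r → ∑ (λ l → ⟨ drop (r ℕ.* m) g , vector l ⟩ * u l)) (≡.sym (Fin.toℕ-fromℕ< r<e)) ⟩
        _                                                               ≈⟨ eu (fromℕ< r<e) ⟩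
        0#                                                              ∎
      ... | no r≮e = ≈-trans (pair-congˡ {drop (r ℕ.* m) g} {drop ((r ℕ.∸ e) ℕ.* m) h′} (combination u) shifted)
              (rows (orthogonal-combination {suc i} {h′} (λ l → orthogonal-suc ext (orthogonal l) (y≈0 l)) u) (r ℕ.∸ e)
                (ℕ.+-cancelˡ-< e _ _ (≡.subst₂ ℕ._<_ (≡.sym (ℕ.m+[n∸m]≡n (ℕ.≮⇒≥ r≮e))) (≡.trans (≡.sym i+e≡k) (ℕ.+-comm (suc i) e)) r<k)))
        where
        shifted : ∀ t → g (r ℕ.* m ℕ.+ t) ≡ h′ ((r ℕ.∸ e) ℕ.* m ℕ.+ t)
        shifted t = ≡.trans (≡.cong g (≡.trans (≡.cong (λ x → x ℕ.* m ℕ.+ t) (≡.sym (ℕ.m+[n∸m]≡n (ℕ.≮⇒≥ r≮e))))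
          (≡.trans (≡.cong (ℕ._+ t) (ℕ.*-distribʳ-+ m e (r ℕ.∸ e))) (ℕ.+-assoc (e ℕ.* m) _ t)))) (extg _)

  -- Otherwise the orthogonal space would be stable under the nilpotent shift by m,
  -- while all its elements vanish on the first m places.
  no-escape : ∀ {i h e} (B : Basis i h (suc e)) → let open Basis B in
    (∀ l → m ℕ.≤ pivot l) → (∀ l → ⟨ h , drop m (vector l) ⟩ ≈ 0#) → ⊥
  no-escape {i} {h} B high z = 1≉0 (≈-trans (≈-sym (diagonal zero)) (vanish _ (orthogonal zero) ℕ.≤-refl))
    where
    open Basis B
    bottom : ∀ {w} → Orthogonal i h w → ∀ t → t ℕ.< m → w t ≈ 0#
    bottom {w} o t t<m = ≈-trans (expansion o t) (∑-zero _ λ l → ≈-trans (*-congˡ (low l (high l) t t<m)) (zeroʳ (w (pivot l))))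
    orthogonal-drop : ∀ {w} → Orthogonal i h w → Orthogonal i h (drop m w)
    orthogonal-drop {w} o = record
      { supported = λ t k≤t → supported o (m ℕ.+ t) (ℕ.m≤n⇒m≤o+n m k≤t)
      ; rows = λ
        { zero    _   → ≈-trans (range-cong k λ t _ → *-congˡ {h t} (expansion o (m ℕ.+ t)))
                          (≈-trans (pair-combination h m (w ∘ pivot)) (∑-zero _ λ l → ≈-trans (*-congˡ (z l)) (zeroʳ (w (pivot l)))))
        ; (suc j) j<i → ≈-trans (pair-congˡ (drop m w) λ t → ≡.cong h (swap j t))
                          (≈-trans (≈-sym (pair-drop {drop (j ℕ.* m) h} {w} (bottom o) (supported o))) (rows o j (ℕ.<⇒≤ j<i))) } }
      where
      swap : ∀ j t → m ℕ.+ j ℕ.* m ℕ.+ t ≡ j ℕ.* m ℕ.+ (m ℕ.+ t)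
      swap j t = ≡.trans (≡.cong (ℕ._+ t) (ℕ.+-comm m (j ℕ.* m))) (ℕ.+-assoc (j ℕ.* m) m t)
    vanish : ∀ b {w} → Orthogonal i h w → ∀ {t} → t ℕ.≤ b → w t ≈ 0#
    vanish b {w} o {t} t≤b with t ℕ.<? m
    ... | yes t<m = bottom o t t<m
    vanish zero    o t≤b | no t≮m = ⊥-elim (t≮m (ℕ.≤-<-trans t≤b (ℕ.>-nonZero⁻¹ m)))
    vanish (suc b) {w} o {t} t≤b | no t≮m = ≈-trans (reflexive (≡.cong w (≡.sym (ℕ.m+[n∸m]≡n (ℕ.≮⇒≥ t≮m)))))
      (vanish b (orthogonal-drop o) (ℕ.s≤s⁻¹ (ℕ.≤-trans (ℕ.∸-monoʳ-< {t} {m} {0} (ℕ.>-nonZero⁻¹ m) (ℕ.≮⇒≥ t≮m)) t≤b)))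

-- Counting the continuations that give a nonsingular matrix

module PowerProducts (q : ℕ) where

  -- Together with `∏[qⁱ-1]`, the denominator and numerator of `∏[1-q⁻ⁱ]`, kept apart so that the
  -- counting takes place in ℕ.
  ∏qⁱ : ℕ → ℕ
  ∏qⁱ zero    = 1
  ∏qⁱ (suc r) = ∏qⁱ r ℕ.* q ℕ.^ suc r

  ∏[qⁱ-1] : ℕ → ℕ
  ∏[qⁱ-1] zero    = 1
  ∏[qⁱ-1] (suc r) = ∏[qⁱ-1] r ℕ.* (q ℕ.^ suc r ℕ.∸ 1)

module Counting {q : ℕ} (F : FiniteField q c ℓ) (k m : ℕ) .{{_ : NonZero m}} where

  open FiniteField F
  open DeterminantProperties commutativeRing using (det)
  open Streams F
  open Pairing k
  open Sliding F k m
  open PowerProducts q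

  #nonsingular : ℕ → Stream → ℕ
  #nonsingular N = total N λ h → ⟦ nonsingular? h ⟧

  module _ {e : ℕ} (D : DualFamily e) where

    open DualFamily D

    total-¬annihilates : ∀ s h → total s (λ g → ⟦ ¬? (annihilates? s g) ⟧) h ℕ.* q ℕ.^ rank s ≡ q ℕ.^ s ℕ.* (q ℕ.^ rank s ℕ.∸ 1)
    total-¬annihilates s h = begin
      N′ ℕ.* R                     ≡⟨ ≡.sym (ℕ.m+n∸n≡m (N′ ℕ.* R) (N ℕ.* R)) ⟩
      N′ ℕ.* R ℕ.+ N ℕ.* R ℕ.∸ N ℕ.* R ≡⟨ ≡.cong₂ ℕ._∸_ (≡.sym (ℕ.*-distribʳ-+ R N′ N)) (total-annihilates s h) ⟩
      (N′ ℕ.+ N) ℕ.* R ℕ.∸ q ℕ.^ s ≡⟨ ≡.cong₂ (λ x y → x ℕ.* R ℕ.∸ y) all (≡.sym (ℕ.*-identityʳ (q ℕ.^ s))) ⟩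
      q ℕ.^ s ℕ.* R ℕ.∸ q ℕ.^ s ℕ.* 1    ≡⟨ ≡.sym (ℕ.*-distribˡ-∸ (q ℕ.^ s) R 1) ⟩
      q ℕ.^ s ℕ.* (R ℕ.∸ 1)        ∎
      where
      open ≡-Reasoning
      R  = q ℕ.^ rank s
      N  = total s (λ g → ⟦ annihilates? s g ⟧) h
      N′ = total s (λ g → ⟦ ¬? (annihilates? s g) ⟧) h
      all : N′ ℕ.+ N ≡ q ℕ.^ s
      all = ≡.trans (≡.sym (total-add s _ _ h)) (≡.trans (total-cong s λ g _ → ⟦⟧-¬ (annihilates? s g))
        (≡.trans (total-const s 1 h) (ℕ.*-identityʳ _)))

    -- The factor of exponent `suc r` enters here: annihilating readings contribute nothing, and
    -- after every other reading the proportion among `C` continuations is the product up to `r`.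
    -- The number `s` of fresh values is left free, since the first window receives `p` of them and
    -- each later one `m`.
    total-hit : ∀ s {h} (φ : Stream → ℕ) {r C} → rank s ≡ suc r →
      (∀ g → Extends s h g → Annihilates s g → φ g ≡ 0) →
      (∀ g → Extends s h g → ¬ Annihilates s g → φ g ℕ.* ∏qⁱ r ≡ C ℕ.* ∏[qⁱ-1] r) →
      total s φ h ℕ.* ∏qⁱ (suc r) ≡ q ℕ.^ s ℕ.* C ℕ.* ∏[qⁱ-1] (suc r)
    total-hit s {h} φ {r} {C} rank≡ bad good = begin
      total s φ h ℕ.* (∏qⁱ r ℕ.* R)                        ≡⟨ ≡.sym (ℕ.*-assoc (total s φ h) (∏qⁱ r) R) ⟩
      total s φ h ℕ.* ∏qⁱ r ℕ.* R                          ≡⟨ ≡.cong (ℕ._* R) (≡.sym (total-scale s φ (∏qⁱ r) h)) ⟩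
      total s (λ g → φ g ℕ.* ∏qⁱ r) h ℕ.* R                ≡⟨ ≡.cong (ℕ._* R) (total-cong s each) ⟩
      total s (λ g → ⟦ ¬? (annihilates? s g) ⟧ ℕ.* CΠ) h ℕ.* R   ≡⟨ ≡.cong (ℕ._* R) (total-scale s _ CΠ h) ⟩
      N′ ℕ.* CΠ ℕ.* R                                      ≡⟨ swap N′ CΠ R ⟩
      CΠ ℕ.* (N′ ℕ.* R)                                    ≡⟨ ≡.cong (CΠ ℕ.*_) (≡.subst (λ x → N′ ℕ.* q ℕ.^ x ≡ q ℕ.^ s ℕ.* (q ℕ.^ x ℕ.∸ 1)) rank≡ (total-¬annihilates s h)) ⟩
      CΠ ℕ.* (q ℕ.^ s ℕ.* (R ℕ.∸ 1))                       ≡⟨ regroup C (∏[qⁱ-1] r) (q ℕ.^ s) (R ℕ.∸ 1) ⟩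
      q ℕ.^ s ℕ.* C ℕ.* (∏[qⁱ-1] r ℕ.* (R ℕ.∸ 1))          ∎
      where
      open ≡-Reasoning
      R  = q ℕ.^ suc r
      CΠ = C ℕ.* ∏[qⁱ-1] r
      N′ = total s (λ g → ⟦ ¬? (annihilates? s g) ⟧) h
      each : ∀ g → Extends s h g → φ g ℕ.* ∏qⁱ r ≡ ⟦ ¬? (annihilates? s g) ⟧ ℕ.* CΠ
      each g ext with annihilates? s g
      ... | yes z = ≡.cong (ℕ._* ∏qⁱ r) (bad g ext z)
      ... | no ¬z = ≡.trans (good g ext ¬z) (≡.sym (ℕ.*-identityˡ CΠ))
      swap : ∀ x y z → x ℕ.* y ℕ.* z ≡ y ℕ.* (x ℕ.* z)
      swap = ℕ-Solver.solve-∀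
      regroup : ∀ x y z w → x ℕ.* y ℕ.* (z ℕ.* w) ≡ z ℕ.* x ℕ.* (y ℕ.* w)
      regroup = ℕ-Solver.solve-∀

  module _ {i : ℕ} {h h′ : Stream} {e : ℕ} (B : Basis i h (suc e)) (ext : Extends m h h′) where

    open Basis B

    rank-advance : ∀ j y≉0 tame → rank m ≡ ⟦ pivot j ℕ.<? m ⟧ ℕ.+ Basis.rank (advance {h′ = h′} B ext j y≉0 tame) m
    rank-advance j _ _ = ℕ∑.sum-remove {i = j} λ l → ⟦ pivot l ℕ.<? m ⟧

  -- Induction on the number of windows to come. The count depends on the basis only through its
  -- rank, so the vector to be spent may be chosen after the fresh values are known. When no window
  -- is left, completeness without pivots says that the kernel is zero.
  total-nonsingular : ∀ e {i h} (B : Basis i h e) → i ℕ.+ e ≡ k →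
    #nonsingular (e ℕ.* m) h ℕ.* ∏qⁱ (Basis.rank B m) ≡ q ℕ.^ (e ℕ.* m) ℕ.* ∏[qⁱ-1] (Basis.rank B m)
  total-nonsingular zero {i} {h} B i≡k = ≡.cong (ℕ._* 1) (⟦⟧-yes (nonsingular? h) λ z → impossible (singular⇒kernel {h} z))
    where
    impossible : (∃ λ w → Orthogonal k h w × ∃ λ t → ¬ w t ≈ 0#) → ⊥
    impossible (w , o , t , w≉0) = w≉0 (Basis.complete B w (≡.subst (λ i → Orthogonal i h w) (≡.trans (≡.sym i≡k) (ℕ.+-identityʳ i)) o) (λ ()) t)
  total-nonsingular (suc e) {i} {h} B i+e≡k = ≡.trans (≡.cong (ℕ._* ∏qⁱ (rank m)) (total-+ m (e ℕ.* m) _ h)) (≡.trans (step (rank m) refl)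
      (≡.cong (ℕ._* ∏[qⁱ-1] (rank m)) (≡.sym (ℕ.^-distribˡ-+-* q m (e ℕ.* m)))))
    where
    open Basis B
    E = q ℕ.^ (e ℕ.* m)
    i+e≡k′ : suc i ℕ.+ e ≡ k
    i+e≡k′ = ≡.trans (≡.sym (ℕ.+-suc i e)) i+e≡k
    next : ∀ g → Extends m h g → ∀ j → ¬ ⟨ g , vector j ⟩ ≈ 0# → (∀ l → m ℕ.≤ pivot l → m ℕ.≤ pivot j ⊎ ⟨ g , vector l ⟩ ≈ 0#) →
      ∀ {r} → rank m ≡ ⟦ pivot j ℕ.<? m ⟧ ℕ.+ r → #nonsingular (e ℕ.* m) g ℕ.* ∏qⁱ r ≡ E ℕ.* ∏[qⁱ-1] r
    next g ext j y≉0 tame {r} eq = ≡.subst (λ r → #nonsingular (e ℕ.* m) g ℕ.* ∏qⁱ r ≡ E ℕ.* ∏[qⁱ-1] r)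
      (ℕ.+-cancelˡ-≡ ⟦ pivot j ℕ.<? m ⟧ _ _ (≡.trans (≡.sym (rank-advance {h′ = g} B ext j y≉0 tame)) eq))
      (total-nonsingular e (advance {h′ = g} B ext j y≉0 tame) i+e≡k′)
    determined : ∀ g → Extends m h g → ∀ l → m ℕ.≤ pivot l → ⟨ g , vector l ⟩ ≈ ⟨ h , drop m (vector l) ⟩
    determined g ext l m≤p = ≈-trans (pair-drop {g} {vector l} (low l m≤p) (Orthogonal.supported (orthogonal l)))
      (pair-congˡ (drop m (vector l)) ext)
    step : ∀ r → rank m ≡ r → total m (#nonsingular (e ℕ.* m)) h ℕ.* ∏qⁱ r ≡ q ℕ.^ m ℕ.* E ℕ.* ∏[qⁱ-1] r
    -- Products with vectors of later pivot depend on `h` alone, so the cases are separated before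
    -- the fresh values are read. If such a product is nonzero, that vector is spent and the rank is
    -- unchanged.
    step r rank≡r with Fin.any? (λ l → (m ℕ.≤? pivot l) ×-dec ¬? (⟨ h , drop m (vector l) ⟩ ≟ 0#))
    ... | yes (j , m≤p , y≉0) = ≡.trans (≡.sym (total-scale m (#nonsingular (e ℕ.* m)) (∏qⁱ r) h))
            (≡.trans (total-cong m λ g ext → next g ext j (λ z → y≉0 (≈-trans (≈-sym (determined g ext j m≤p)) z)) (λ _ _ → inj₁ m≤p)
                (≡.trans rank≡r (≡.cong (ℕ._+ r) (≡.sym (⟦⟧-no (pivot j ℕ.<? m) (ℕ.≤⇒≯ m≤p))))))
              (≡.trans (total-const m (E ℕ.* ∏[qⁱ-1] r) h) (≡.sym (ℕ.*-assoc (q ℕ.^ m) E (∏[qⁱ-1] r)))))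
    ... | no none = hit r rank≡r
      where
      flat : ∀ l → m ℕ.≤ pivot l → ⟨ h , drop m (vector l) ⟩ ≈ 0#
      flat l m≤p = decidable-stable (⟨ h , drop m (vector l) ⟩ ≟ 0#) λ y≉0 → none (l , m≤p , y≉0)
      hit : ∀ r → rank m ≡ r → total m (#nonsingular (e ℕ.* m)) h ℕ.* ∏qⁱ r ≡ q ℕ.^ m ℕ.* E ℕ.* ∏[qⁱ-1] r
      -- Rank 0 puts all pivots at `m` or beyond; with all determined products zero, `no-escape`
      -- rules this out.
      hit zero rank≡0 = ⊥-elim (no-escape B high λ l → flat l (high l))
        where
        high : ∀ l → m ℕ.≤ pivot l
        high l = ℕ.≮⇒≥ λ p<m → ℕ.1+n≢0 (≡.trans (≡.sym (⟦⟧-yes (pivot l ℕ.<? m) p<m)) (∑ℕ-zero⁻ (λ l → ⟦ pivot l ℕ.<? m ⟧) rank≡0 l))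
      hit (suc r) rank≡ = total-hit family m (#nonsingular (e ℕ.* m)) rank≡ singular pivotal
        where
        flat′ : ∀ g → Extends m h g → ∀ l → m ℕ.≤ pivot l → ⟨ g , vector l ⟩ ≈ 0#
        flat′ g ext l m≤p = ≈-trans (determined g ext l m≤p) (flat l m≤p)
        singular : ∀ g → Extends m h g → Annihilates m g → #nonsingular (e ℕ.* m) g ≡ 0
        singular g ext z = ≡.trans
          (total-cong (e ℕ.* m) λ g′ ext′ → ⟦⟧-no (nonsingular? g′) λ ns → ns (doomed B ext i+e≡k′ all g′ ext′))
          (≡.trans (total-const (e ℕ.* m) 0 g) (ℕ.*-zeroʳ (q ℕ.^ (e ℕ.* m))))
          where
          all : ∀ l → ⟨ g , vector l ⟩ ≈ 0#
          all l with pivot l ℕ.<? m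
          ... | yes p<m = z l p<m
          ... | no  p≮m = flat′ g ext l (ℕ.≮⇒≥ p≮m)
        pivotal : ∀ g → Extends m h g → ¬ Annihilates m g → #nonsingular (e ℕ.* m) g ℕ.* ∏qⁱ r ≡ E ℕ.* ∏[qⁱ-1] r
        pivotal g ext ¬z with Fin.any? (λ l → (pivot l ℕ.<? m) ×-dec ¬? (⟨ g , vector l ⟩ ≟ 0#))
        -- A vector with pivot below `m` is spent, so the rank drops to `r`; those with later pivots
        -- have product 0 and receive a zero correction.
        ... | yes (j , p<m , y≉0) = next g ext j y≉0 (λ l m≤p → inj₂ (flat′ g ext l m≤p))
                (≡.trans rank≡ (≡.cong (ℕ._+ r) (≡.sym (⟦⟧-yes (pivot j ℕ.<? m) p<m))))
        ... | no none′ = ⊥-elim (¬z λ l p<m → decidable-stable (⟨ g , vector l ⟩ ≟ 0#) λ y≉0 → none′ (l , p<m , y≉0))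

-- The first window, that is, the bottom row

count-below : ∀ k s → ℕ∑.sum {k} (λ i → ⟦ toℕ i ℕ.<? s ⟧) ≡ k ℕ.⊓ s
count-below zero    s       = refl
count-below (suc k) zero    = ∑ℕ-zero {suc k} (λ i → ⟦ toℕ i ℕ.<? 0 ⟧) λ i → ⟦⟧-no (toℕ i ℕ.<? 0) λ ()
count-below (suc k) (suc s) = ≡.cong₂ ℕ._+_ (⟦⟧-yes (0 ℕ.<? suc s) ℕ.z<s)
  (≡.trans (ℕ∑.sum-cong-≗ {k} λ i → ⟦⟧-cong (suc (toℕ i) ℕ.<? suc s) (toℕ i ℕ.<? s) ℕ.s≤s⁻¹ s≤s) (count-below k s))

module FirstRow {q : ℕ} (F : FiniteField q c ℓ) (k′ n : ℕ) where

  private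
    k m : ℕ
    k = suc k′
    m = suc n

  open FiniteField F
  open DeterminantProperties commutativeRing using (∑-single)
  open SemiringSum semiring renaming (sum to ∑)
  open Streams F
  open Pairing k
  open Sliding F k m
  open Counting F k m
  open PowerProducts q

  unit : Fin k → Stream
  unit l t with t ℕ.≟ toℕ l
  ... | yes _ = 1#
  ... | no  _ = 0#

  unit-≡ : ∀ l {t} → t ≡ toℕ l → unit l t ≈ 1#
  unit-≡ l {t} e with t ℕ.≟ toℕ l
  ... | yes _ = ≈-refl
  ... | no ≢  = ⊥-elim (≢ e)

  unit-≢ : ∀ l {t} → t ≢ toℕ l → unit l t ≈ 0#
  unit-≢ l {t} ≢ with t ℕ.≟ toℕ l
  ... | yes e = ⊥-elim (≢ e)
  ... | no _  = ≈-refl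

  -- Before any window is read every vector is orthogonal, whatever the past.
  standard : ∀ h → Basis 0 h k
  standard h = record
    { family = record
      { vector       = unit
      ; pivot        = toℕ
      ; pivot<k      = Fin.toℕ<n
      ; diagonal     = λ l → unit-≡ l refl
      ; off-diagonal = λ l l′ l≢l′ → unit-≢ l λ e → l≢l′ (Fin.toℕ-injective (≡.sym e))
      }
    ; orthogonal = λ l → record
      { supported = λ t k≤t → unit-≢ l λ e → ℕ.<⇒≱ (Fin.toℕ<n l) (≡.subst (k ℕ.≤_) e k≤t)
      ; rows      = λ _ () }
    ; complete   = complete
    ; low        = λ l m≤l t t<m → unit-≢ l λ e → ℕ.<⇒≱ t<m (≡.subst (m ℕ.≤_) (≡.sym e) m≤l)
    }
    where
    complete : ∀ w → Orthogonal 0 h w → (∀ l → w (toℕ l) ≈ 0#) → ∀ t → w t ≈ 0#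
    complete w o z t with t ℕ.<? k
    ... | yes t<k = ≈-trans (reflexive (≡.cong w (≡.sym (Fin.toℕ-fromℕ< t<k)))) (z (fromℕ< t<k))
    ... | no  t≮k = Orthogonal.supported o t (ℕ.≮⇒≥ t≮k)

  pair-unit : ∀ g l → ⟨ g , unit l ⟩ ≈ g (toℕ l)
  pair-unit g l = ≈-trans (∑-single l (λ t → g (toℕ t) * unit l (toℕ t))
      λ t t≢l → ≈-trans (*-congˡ (unit-≢ l (t≢l ∘ Fin.toℕ-injective))) (zeroʳ (g (toℕ t))))
    (≈-trans (*-congˡ (unit-≡ l refl)) (*-identityʳ (g (toℕ l))))

  -- The standard basis has `k ⊓ m` pivots below `m`, and the bottom row uses up one of them, which
  -- leaves `k′ ⊓ n`. The zeros of the row from place `m` on supply the condition `tame`.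
  after-first-row : ∀ g j → toℕ j ℕ.< m → ¬ g (toℕ j) ≈ 0# → (∀ t → t ℕ.< k → m ℕ.≤ t → g t ≈ 0#) →
    #nonsingular (k′ ℕ.* m) g ℕ.* ∏qⁱ (k′ ℕ.⊓ n) ≡ q ℕ.^ (k′ ℕ.* m) ℕ.* ∏[qⁱ-1] (k′ ℕ.⊓ n)
  after-first-row g j j<m y≉0 flat = ≡.subst (λ r → #nonsingular (k′ ℕ.* m) g ℕ.* ∏qⁱ r ≡ q ℕ.^ (k′ ℕ.* m) ℕ.* ∏[qⁱ-1] r)
    rank≡ (total-nonsingular k′ (advance {h′ = g} B ext j y≉0′ tame) refl)
    where
    -- `drop m g` serves as the past of `g` here, although the first window arises by reading `p`
    -- values and not `m`.
    B = standard (drop m g)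
    ext : Extends m (drop m g) g
    ext _ = refl
    y≉0′ : ¬ ⟨ g , unit j ⟩ ≈ 0#
    y≉0′ z = y≉0 (≈-trans (≈-sym (pair-unit g j)) z)
    tame : ∀ l → m ℕ.≤ toℕ l → m ℕ.≤ toℕ j ⊎ ⟨ g , unit l ⟩ ≈ 0#
    tame l m≤l = inj₂ (≈-trans (pair-unit g l) (flat (toℕ l) (Fin.toℕ<n l) m≤l))
    r′ = Basis.rank (advance {h′ = g} B ext j y≉0′ tame) m
    rank≡ : r′ ≡ k′ ℕ.⊓ n
    rank≡ = ℕ.suc-injective (≡.trans (≡.cong (ℕ._+ r′) (≡.sym (⟦⟧-yes (toℕ j ℕ.<? m) j<m)))
      (≡.trans (≡.sym (rank-advance {h′ = g} B ext j y≉0′ tame)) (count-below k m)))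

  -- The bottom row has h₀ = 1 at place `p` and only zeros after it, so it is nonzero whatever is
  -- read; `p ≤ n` puts this place below `m`.
  short-first-row : ∀ p → p ℕ.≤ k′ → p ℕ.≤ n →
    #nonsingular (p ℕ.+ k′ ℕ.* m) h₀ ℕ.* ∏qⁱ (k′ ℕ.⊓ n) ≡ q ℕ.^ (p ℕ.+ k′ ℕ.* m) ℕ.* ∏[qⁱ-1] (k′ ℕ.⊓ n)
  short-first-row p p≤k′ p≤n = begin
    #nonsingular (p ℕ.+ E) h₀ ℕ.* ∏qⁱ r                        ≡⟨ ≡.cong (ℕ._* ∏qⁱ r) (total-+ p E _ h₀) ⟩
    total p (#nonsingular E) h₀ ℕ.* ∏qⁱ r                       ≡⟨ ≡.sym (total-scale p (#nonsingular E) (∏qⁱ r) h₀) ⟩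
    total p (λ g → #nonsingular E g ℕ.* ∏qⁱ r) h₀               ≡⟨ total-cong p (λ g ext → after-first-row g (fromℕ< p<k)
                                                                      (≡.subst (ℕ._< m) (≡.sym (Fin.toℕ-fromℕ< p<k)) (s≤s p≤n)) (one g ext) (zeros g ext)) ⟩
    total p (λ _ → q ℕ.^ E ℕ.* ∏[qⁱ-1] r) h₀                    ≡⟨ total-const p _ h₀ ⟩
    q ℕ.^ p ℕ.* (q ℕ.^ E ℕ.* ∏[qⁱ-1] r)                         ≡⟨ ≡.sym (ℕ.*-assoc (q ℕ.^ p) (q ℕ.^ E) _) ⟩
    q ℕ.^ p ℕ.* q ℕ.^ E ℕ.* ∏[qⁱ-1] r                           ≡⟨ ≡.cong (ℕ._* ∏[qⁱ-1] r) (≡.sym (ℕ.^-distribˡ-+-* q p E)) ⟩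
    q ℕ.^ (p ℕ.+ E) ℕ.* ∏[qⁱ-1] r                               ∎
    where
    open ≡-Reasoning
    E = k′ ℕ.* m
    r = k′ ℕ.⊓ n
    p<k : p ℕ.< k
    p<k = s≤s p≤k′
    one : ∀ g → Extends p h₀ g → ¬ g (toℕ (fromℕ< p<k)) ≈ 0#
    one g ext z = 1≉0 (≈-trans (reflexive (≡.sym (≡.trans (≡.cong g (≡.trans (Fin.toℕ-fromℕ< p<k) (≡.sym (ℕ.+-identityʳ p)))) (ext 0)))) z)
    zeros : ∀ g → Extends p h₀ g → ∀ t → t ℕ.< k → m ℕ.≤ t → g t ≈ 0#
    zeros g ext t _ m≤t = reflexive (≡.trans (≡.cong g (≡.sym (≡.trans (ℕ.+-suc p _) (ℕ.m+[n∸m]≡n (ℕ.≤-trans (s≤s p≤n) m≤t))))) (ext (suc (t ℕ.∸ suc p))))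

  -- The bottom row consists of `k` freely read values. It vanishes with probability q⁻ᵏ, which
  -- supplies the factor for i = k.
  long-first-row : ∀ p → k ℕ.≤ p → k ℕ.≤ m →
    #nonsingular (p ℕ.+ k′ ℕ.* m) h₀ ℕ.* ∏qⁱ k ≡ q ℕ.^ (p ℕ.+ k′ ℕ.* m) ℕ.* ∏[qⁱ-1] k
  long-first-row p k≤p k≤m = ≡.trans (≡.cong (ℕ._* ∏qⁱ k) (total-+ p E _ h₀))
    (≡.trans (total-hit (Basis.family (standard h₀)) p (#nonsingular E) (≡.trans (count-below k p) (ℕ.m≤n⇒m⊓n≡m k≤p)) bad good)
      (≡.cong (ℕ._* ∏[qⁱ-1] k) (≡.sym (ℕ.^-distribˡ-+-* q p E))))
    where
    E = k′ ℕ.* m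
    open DualFamily (Basis.family (standard h₀)) using (Annihilates)
    bad : ∀ g → Extends p h₀ g → Annihilates p g → #nonsingular E g ≡ 0
    bad g _ z = ≡.trans
      (total-cong E λ g′ ext′ → ⟦⟧-no (nonsingular? g′) λ ns → ns (doomed {h′ = g} (standard (drop m g)) (λ _ → refl) refl
        (λ l → z l (ℕ.<-≤-trans (Fin.toℕ<n l) k≤p)) g′ ext′))
      (≡.trans (total-const E 0 g) (ℕ.*-zeroʳ (q ℕ.^ E)))
    good : ∀ g → Extends p h₀ g → ¬ Annihilates p g → #nonsingular E g ℕ.* ∏qⁱ k′ ≡ q ℕ.^ E ℕ.* ∏[qⁱ-1] k′
    good g _ ¬z with Fin.any? {k} (λ l → ¬? (g (toℕ l) ≟ 0#))
    ... | yes (j , y≉0) = ≡.subst (λ r → #nonsingular E g ℕ.* ∏qⁱ r ≡ q ℕ.^ E ℕ.* ∏[qⁱ-1] r) (ℕ.m≤n⇒m⊓n≡m (ℕ.s≤s⁻¹ k≤m))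
            (after-first-row g j (ℕ.<-≤-trans (Fin.toℕ<n j) k≤m) y≉0 λ t t<k m≤t → ⊥-elim (ℕ.<⇒≱ (ℕ.<-≤-trans t<k k≤m) m≤t))
    ... | no none = ⊥-elim (¬z λ l _ → ≈-trans (pair-unit g l) (decidable-stable (g (toℕ l) ≟ 0#) λ y≉0 → none (l , y≉0)))

-- From counts to rational frequencies

/-+-/ : ∀ a b d .{{_ : NonZero d}} → (+ a) ℚ./ d ℚ.+ (+ b) ℚ./ d ≡ (+ (a ℕ.+ b)) ℚ./ d
/-+-/ a b d@(suc d-1) = ℚ.toℚᵘ-injective (begin
  ℚ.toℚᵘ (+ a ℚ./ d ℚ.+ + b ℚ./ d)                 ≈⟨ ℚ.toℚᵘ-homo-+ (+ a ℚ./ d) (+ b ℚ./ d) ⟩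
  ℚ.toℚᵘ (+ a ℚ./ d) ℚᵘ.+ ℚ.toℚᵘ (+ b ℚ./ d)       ≈⟨ ℚᵘ.+-cong (ℚ.toℚᵘ-fromℚᵘ (mkℚᵘ (+ a) d-1)) (ℚ.toℚᵘ-fromℚᵘ (mkℚᵘ (+ b) d-1)) ⟩
  mkℚᵘ (+ a) d-1 ℚᵘ.+ mkℚᵘ (+ b) d-1               ≈⟨ *≡* (≡.trans (identity (+ a) (+ b) (+ d)) (≡.cong (λ x → x ℤ.* (+ d ℤ.* + d)) (≡.sym (ℤ.pos-+ a b)))) ⟩
  mkℚᵘ (+ (a ℕ.+ b)) d-1                           ≈⟨ ℚᵘ.≃-sym (ℚ.toℚᵘ-fromℚᵘ (mkℚᵘ (+ (a ℕ.+ b)) d-1)) ⟩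
  ℚ.toℚᵘ (+ (a ℕ.+ b) ℚ./ d)                       ∎)
  where
  open import Relation.Binary.Reasoning.Setoid ℚᵘ.≃-setoid
  identity : ∀ x y z → (x ℤ.* z ℤ.+ y ℤ.* z) ℤ.* z ≡ (x ℤ.+ y) ℤ.* (z ℤ.* z)
  identity = ℤ-Solver.solve-∀

/-*-/ : ∀ a b d e .{{_ : NonZero d}} .{{_ : NonZero e}} →
  ((+ a) ℚ./ d) ℚ.* ((+ b) ℚ./ e) ≡ ((+ (a ℕ.* b)) ℚ./ (d ℕ.* e)) {{ℕ.m*n≢0 d e}}
/-*-/ a b d@(suc d-1) e@(suc e-1) = ℚ.toℚᵘ-injective (begin
  ℚ.toℚᵘ ((+ a ℚ./ d) ℚ.* (+ b ℚ./ e))                 ≈⟨ ℚ.toℚᵘ-homo-* (+ a ℚ./ d) (+ b ℚ./ e) ⟩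
  ℚ.toℚᵘ (+ a ℚ./ d) ℚᵘ.* ℚ.toℚᵘ (+ b ℚ./ e)       ≈⟨ ℚᵘ.*-cong (ℚ.toℚᵘ-fromℚᵘ (mkℚᵘ (+ a) d-1)) (ℚ.toℚᵘ-fromℚᵘ (mkℚᵘ (+ b) e-1)) ⟩
  mkℚᵘ (+ a) d-1 ℚᵘ.* mkℚᵘ (+ b) e-1               ≈⟨ *≡* (≡.cong (ℤ._* + (d ℕ.* e)) (≡.sym (ℤ.pos-* a b))) ⟩
  mkℚᵘ (+ (a ℕ.* b)) (e-1 ℕ.+ d-1 ℕ.* e)           ≈⟨ ℚᵘ.≃-sym (ℚ.toℚᵘ-fromℚᵘ (mkℚᵘ (+ (a ℕ.* b)) (e-1 ℕ.+ d-1 ℕ.* e))) ⟩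
  ℚ.toℚᵘ (+ (a ℕ.* b) ℚ./ (d ℕ.* e))               ∎)
  where open import Relation.Binary.Reasoning.Setoid ℚᵘ.≃-setoid

n/n≡1 : ∀ n .{{_ : NonZero n}} → (+ n) ℚ./ n ≡ 1ℚ
n/n≡1 (suc n) = ℚ.fromℚᵘ-cong {mkℚᵘ (+ suc n) n} {mkℚᵘ 1ℤ 0} (*≡* (ℤ.*-comm (+ suc n) 1ℤ))

complement-/ : ∀ a b {d} .{{_ : NonZero d}} → a ℕ.+ b ≡ d → (+ a) ℚ./ d ≡ 1ℚ ℚ.- (+ b) ℚ./ d
complement-/ a b {d} refl = begin
  x                    ≡⟨ ≡.sym (ℚ.+-identityʳ x) ⟩
  x ℚ.+ ℚ.0ℚ           ≡⟨ ≡.cong (x ℚ.+_) (≡.sym (ℚ.+-inverseʳ y)) ⟩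
  x ℚ.+ (y ℚ.- y)      ≡⟨ ≡.sym (ℚ.+-assoc x y (ℚ.- y)) ⟩
  x ℚ.+ y ℚ.- y        ≡⟨ ≡.cong (ℚ._- y) (≡.trans (/-+-/ a b d) (n/n≡1 d)) ⟩
  1ℚ ℚ.- y             ∎
  where
  open ≡-Reasoning
  x = (+ a) ℚ./ d
  y = (+ b) ℚ./ d

module Frequency {q : ℕ} (F : FiniteField q c ℓ) where

  open FiniteField F using (q^-nonZero)
  open Probability F using (∏[1-q⁻ⁱ]; scale-/)
  open PowerProducts q

  ∏qⁱ-nonZero : ∀ r → NonZero (∏qⁱ r)
  ∏qⁱ-nonZero zero    = _
  ∏qⁱ-nonZero (suc r) = ℕ.m*n≢0 (∏qⁱ r) (q ℕ.^ suc r) {{∏qⁱ-nonZero r}} {{q^-nonZero (suc r)}}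

  ∏-fraction : ∀ r → ∏[1-q⁻ⁱ] r ≡ ((+ ∏[qⁱ-1] r) ℚ./ ∏qⁱ r) {{∏qⁱ-nonZero r}}
  ∏-fraction zero    = refl
  ∏-fraction (suc r) = ≡.trans
    (≡.cong₂ ℚ._*_ (∏-fraction r) (≡.sym (complement-/ (q ℕ.^ suc r ℕ.∸ 1) 1 {{q^-nonZero (suc r)}}
      (ℕ.m∸n+n≡m (ℕ.>-nonZero⁻¹ (q ℕ.^ suc r) {{q^-nonZero (suc r)}})))))
    (/-*-/ (∏[qⁱ-1] r) (q ℕ.^ suc r ℕ.∸ 1) (∏qⁱ r) (q ℕ.^ suc r) {{∏qⁱ-nonZero r}} {{q^-nonZero (suc r)}})

  -- The counting identity for `b` is the equality of `b / q ^ N` with the fraction in `∏-fraction`,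
  -- cross-multiplied.
  complementary-frequency : ∀ N r {a b} → a ℕ.+ b ≡ q ℕ.^ N → b ℕ.* ∏qⁱ r ≡ q ℕ.^ N ℕ.* ∏[qⁱ-1] r →
    ((+ a) ℚ./ q ℕ.^ N) {{q^-nonZero N}} ≡ 1ℚ ℚ.- ∏[1-q⁻ⁱ] r
  complementary-frequency N r {a} {b} a+b≡ e = ≡.trans (complement-/ a b {{q^-nonZero N}} a+b≡)
    (≡.cong (λ x → 1ℚ ℚ.- x) (≡.trans
      (scale-/ b (∏[qⁱ-1] r) (q ℕ.^ N) (∏qⁱ r) {{q^-nonZero N}} {{∏qⁱ-nonZero r}} (≡.trans e (ℕ.*-comm (q ℕ.^ N) _)))
      (≡.sym (∏-fraction r))))

-- Evaluating Schur functions on streams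

open import Data.Nat.Base using (_+_; _∸_; _<_; _≤_; _≥_; _≤ᵇ_)
open import Data.Rational.Base using (_-_)

open Determinant 𝒫 using () renaming (Matrix to Matrixᴾ; det to detᴾ)
open SemiringSum (CommutativeRing.semiring 𝒫) using () renaming (sum to ∑ᴾ)
open Exp (CommutativeRing.semiring 𝒫) using () renaming (_^_ to _^ᴾ_)

minorᴾ : ∀ {n} → Matrixᴾ (suc n) → Fin (suc n) → Matrixᴾ n
minorᴾ A j r s = A (suc r) (punchIn j s)

termᴾ : ∀ {n} → Matrixᴾ (suc n) → Fin (suc n) → Poly
termᴾ A j = (⊝ con (+ 1)) ^ᴾ toℕ j ⊗ (A zero j ⊗ detᴾ (minorᴾ A j))

within-∑ : ∀ N {n} (f : Fin n → Poly) → (∀ i → Within N (f i)) → Within N (∑ᴾ f)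
within-∑ N {zero}  f w = tt
within-∑ N {suc n} f w = w zero , within-∑ N (f ∘ suc) (w ∘ suc)

within-^ : ∀ N f n → Within N f → Within N (f ^ᴾ n)
within-^ N f zero    w = tt
within-^ N f (suc n) w = w , within-^ N f n w

within-det : ∀ N {n} (A : Matrixᴾ n) → (∀ i j → Within N (A i j)) → Within N (detᴾ A)
within-det N {zero}  A w = tt
within-det N {suc n} A w = within-∑ N (termᴾ A) λ j →
  within-^ N (⊝ con (+ 1)) (toℕ j) tt , w zero j , within-det N (minorᴾ A j) λ r s → w (suc r) (punchIn j s)

-- The index `N - t` never exceeds `N`, and an index that is zero or negative gives a constant.
within-h : ∀ N t → Within N (h (N ⊖ t))
within-h N t with ℕ.≤-total t N
... | inj₁ t≤N = ≡.subst (Within N ∘ h) (≡.sym (ℤ.⊖-≥ t≤N)) (bounded (N ∸ t) (ℕ.m∸n≤m N t))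
  where
  bounded : ∀ d → d ≤ N → Within N (h (+ d))
  bounded zero    _   = tt
  bounded (suc d) d<N = d<N
... | inj₂ N≤t = ≡.subst (Within N ∘ h) (≡.sym (ℤ.⊖-≤ N≤t)) (nonpositive (t ∸ N))
  where
  nonpositive : ∀ d → Within N (h (ℤ.- + d))
  nonpositive zero    = tt
  nonpositive (suc d) = tt

⊖-cross : ∀ x y x′ y′ → x + y′ ≡ x′ + y → x ⊖ y ≡ x′ ⊖ y′
⊖-cross x y x′ y′ e = begin
  x ⊖ y                ≡⟨ ≡.sym (ℤ.+-cancelˡ-⊖ y′ x y) ⟩
  (y′ + x) ⊖ (y′ + y)  ≡⟨ ≡.cong₂ _⊖_ (≡.trans (ℕ.+-comm y′ x) (≡.trans e (ℕ.+-comm x′ y))) (ℕ.+-comm y′ y) ⟩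
  (y + x′) ⊖ (y + y′)  ≡⟨ ℤ.+-cancelˡ-⊖ y x′ y′ ⟩
  x′ ⊖ y′              ∎
  where open ≡-Reasoning

sum-tabulate : ∀ {A : Set c} {n} (f : A → ℕ) (g : Fin n → A) → sum (map f (tabulate g)) ≡ ℕ∑.sum (f ∘ g)
sum-tabulate {n = zero}  f g = refl
sum-tabulate {n = suc n} f g = ≡.cong (_+_ (f (g zero))) (sum-tabulate f (g ∘ suc))

module SchurEvaluation {q : ℕ} (F : FiniteField q c ℓ) where

  open FiniteField F hiding (_+_)
  open Probability F
  open DeterminantProperties commutativeRing using (det; det-cong)
  open SemiringSum semiring renaming (sum to ∑)
  open Exp semiring using (_^_)
  open Streams F hiding (_◁_)

  eval-∑ : ∀ ρ {n} (f : Fin n → Poly) → eval ρ (∑ᴾ f) ≈ ∑ (eval ρ ∘ f)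
  eval-∑ ρ {zero}  f = ≈-refl
  eval-∑ ρ {suc n} f = +-congˡ (eval-∑ ρ (f ∘ suc))

  eval-sign : ∀ ρ n → eval ρ ((⊝ con (+ 1)) ^ᴾ n) ≈ (- 1#) ^ n
  eval-sign ρ zero    = +-identityʳ 1#
  eval-sign ρ (suc n) = *-cong (-‿cong (+-identityʳ 1#)) (eval-sign ρ n)

  eval-det : ∀ ρ {n} (A : Matrixᴾ n) → eval ρ (detᴾ A) ≈ det (λ i j → eval ρ (A i j))
  eval-det ρ {zero}  A = +-identityʳ 1#
  eval-det ρ {suc n} A = ≈-trans (eval-∑ ρ (termᴾ A))
    (sum-cong-≋ λ j → *-cong (eval-sign ρ (toℕ j)) (*-congˡ {x = eval ρ (A zero j)} (eval-det ρ (minorᴾ A j))))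

  -- In contrast to `assign` this reverses the tuple: its first coordinate is read first and ends up
  -- deepest.
  pushes : ∀ {N} → Stream → Vec Carrier N → Stream
  pushes g []      = g
  pushes g (x ∷ z) = pushes (x ◁ g) z

  pushes-extends : ∀ {N} g (z : Vec Carrier N) → Extends N g (pushes g z)
  pushes-extends g []      t = refl
  pushes-extends {suc N} g (x ∷ z) = extends-suc N x g (pushes (x ◁ g) z) (pushes-extends (x ◁ g) z)

  pushes-assign : ∀ {N} g (z : Vec Carrier N) t → t < N → assign z (N ∸ suc t) ≡ pushes g z t
  pushes-assign {suc N} g (x ∷ z) t (s≤s t≤N) with ℕ.m≤n⇒m<n∨m≡n t≤N
  ... | inj₁ t<N = ≡.trans (≡.cong (x ◁ assign z) (≡.sym (ℕ.suc-pred (N ∸ t) {{ℕ.>-nonZero (ℕ.m<n⇒0<n∸m t<N)}})))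
          (≡.trans (≡.cong (assign z) (ℕ.pred[m∸n]≡m∸[1+n] N t)) (pushes-assign (x ◁ g) z t t<N))
  ... | inj₂ refl = ≡.trans (≡.cong (x ◁ assign z) (ℕ.n∸n≡0 N))
          (≡.sym (≡.trans (≡.cong (pushes (x ◁ g) z) (≡.sym (ℕ.+-identityʳ N))) (pushes-extends (x ◁ g) z 0)))

  -- The cases t < N, t = N and t > N are those of an indeterminate, of h₀ = 1 and of a negative
  -- index.
  eval-h : ∀ {N} (z : Vec Carrier N) t → eval (assign z) (h (N ⊖ t)) ≈ pushes h₀ z t
  eval-h {N} z t with ℕ.<-cmp t N
  ... | tri< t<N _ _ = begin
    eval (assign z) (h (N ⊖ t))            ≡⟨ ≡.cong (eval (assign z) ∘ h) (ℤ.⊖-≥ (ℕ.<⇒≤ t<N)) ⟩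
    eval (assign z) (h (+ (N ∸ t)))        ≡⟨ ≡.cong (λ d → eval (assign z) (h (+ d))) (≡.trans (≡.sym (ℕ.suc-pred (N ∸ t) {{ℕ.>-nonZero (ℕ.m<n⇒0<n∸m t<N)}})) (≡.cong suc (ℕ.pred[m∸n]≡m∸[1+n] N t))) ⟩
    assign z (N ∸ suc t)                   ≡⟨ pushes-assign h₀ z t t<N ⟩
    pushes h₀ z t                          ∎
    where open import Relation.Binary.Reasoning.Setoid setoid
  ... | tri≈ _ refl _ = ≈-trans (reflexive (≡.cong (eval (assign z) ∘ h) (ℤ.n⊖n≡0 N))) (≈-trans (+-identityʳ 1#)
          (reflexive (≡.sym (≡.trans (≡.cong (pushes h₀ z) (≡.sym (ℕ.+-identityʳ N))) (pushes-extends h₀ z 0)))))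
  ... | tri> _ _ N<t = reflexive (≡.trans (≡.cong (eval (assign z) ∘ h) (≡.trans (ℤ.⊖-< N<t) (≡.cong (λ d → ℤ.- + d) (≡.sym t∸N))))
          (≡.sym (≡.trans (≡.cong (pushes h₀ z) (≡.trans (≡.sym (ℕ.m+[n∸m]≡n (ℕ.<⇒≤ N<t))) (≡.cong (_+_ N) (≡.sym t∸N)))) (pushes-extends h₀ z _))))
    where
    t∸N : suc (t ∸ suc N) ≡ t ∸ N
    t∸N = ≡.trans (≡.cong suc (≡.sym (ℕ.pred[m∸n]≡m∸[1+n] t N))) (ℕ.suc-pred (t ∸ N) {{ℕ.>-nonZero (ℕ.m<n⇒0<n∸m N<t)}})

  count≡total : ∀ N {A : Event} (A? : U.Decidable A) φ g →
    (∀ z → ⟦ A? (assign {N} z) ⟧ ≡ φ (pushes g z)) → count N A? ≡ total N φ g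
  count≡total zero    A? φ g e = ≡.trans single (e [])
    where
    single : count zero A? ≡ ⟦ A? (assign []) ⟧
    single with A? (assign [])
    ... | yes _ = refl
    ... | no  _ = refl
  count≡total (suc N) A? φ g e = ≡.trans (filter-product A? elements (tuples N))
    (≡.trans (sum-tabulate (λ x → count N (λ ρ → A? (x ◁ ρ))) element)
      (ℕ∑.sum-cong-≗ λ i → count≡total N (λ ρ → A? (element i ◁ ρ)) φ (element i ◁ g) λ z → e (element i ∷ z)))

-- The Jacobi-Trudi matrix of a staircase

module _ {q : ℕ} (F : FiniteField q c ℓ) (p n k : ℕ) .{{_ : NonZero p}} where

  open FiniteField F using (Carrier; 0#; _≈_; ≈-trans; ≈-sym; reflexive; commutativeRing; _≟_)
  open Probability F
  open DeterminantProperties commutativeRing using (det; Matrix; det-cong)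
  open Streams F using (Stream; h₀; total; total-add; total-cong; total-const)
  open SchurEvaluation F
  open Sliding F k (suc n)
  open Counting F k (suc n)
  open PowerProducts q

  private
    s = schur (staircase p n k)

  -- The staircase shape enters here: from one row to the next the part drops by `n` and the row
  -- number grows by 1, so the indices shift by `n + 1`. For positive `k`, `N` is the index of the
  -- top right entry.
  index-identity : ∀ {N} i j → N ≡ p + (k ∸ 1) ℕ.* suc n → i < k → j < k →
    + (p + (k ∸ suc i) ℕ.* n) ℤ.- + i ℤ.+ + j ≡ N ⊖ (i ℕ.* suc n + (k ∸ suc j))
  index-identity {N} i j refl i<k j<k = begin
    + L ℤ.- + i ℤ.+ + j         ≡⟨ ≡.trans (ℤ.+-assoc (+ L) (ℤ.- + i) (+ j)) (≡.trans (≡.cong (λ x → + L ℤ.+ x) (ℤ.+-comm (ℤ.- + i) (+ j))) (≡.sym (ℤ.+-assoc (+ L) (+ j) (ℤ.- + i)))) ⟩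
    + (L + j) ℤ.- + i           ≡⟨ ℤ.m-n≡m⊖n (L + j) i ⟩
    (L + j) ⊖ i                 ≡⟨ ⊖-cross (L + j) i N _ crossed ⟩
    N ⊖ (i ℕ.* suc n + b)       ∎
    where
    open ≡-Reasoning
    a = k ∸ suc i
    b = k ∸ suc j
    L = p + a ℕ.* n
    complement : ∀ i → i < k → k ∸ suc i + i ≡ k ∸ 1
    complement i i<k = ≡.trans (≡.cong (_+ i) (≡.sym (ℕ.∸-+-assoc k 1 i))) (ℕ.m∸n+n≡m (ℕ.∸-monoˡ-≤ 1 i<k))
    regroup : ∀ p a i b j n → p + a ℕ.* n + j + (i ℕ.* suc n + b) ≡ p + ((a + i) ℕ.* n + (b + j)) + i
    regroup = ℕ-Solver.solve-∀
    crossed : L + j + (i ℕ.* suc n + b) ≡ p + (k ∸ 1) ℕ.* suc n + i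
    crossed = ≡.trans (regroup p a i b j n) (≡.cong (λ x → p + x + i)
      (≡.trans (≡.cong₂ (λ x y → x ℕ.* n + y) (complement i i<k) (complement j j<k)) (≡.trans (ℕ.+-comm _ (k ∸ 1)) (≡.sym (ℕ.*-suc (k ∸ 1) n)))))

  private
    N = p + (k ∸ 1) ℕ.* suc n
    parts = applyDownFrom (λ i → p + i ℕ.* n) k
    L≡k : length parts ≡ k
    L≡k = List.length-applyDownFrom (λ i → p + i ℕ.* n) k

    jacobiTrudi : Matrixᴾ (length parts)
    jacobiTrudi i j = h (+ lookup parts i ℤ.- + toℕ i ℤ.+ + toℕ j)

    entry : ∀ i j → jacobiTrudi i j ≡ h (N ⊖ (toℕ i ℕ.* suc n + (k ∸ suc (toℕ j))))
    entry i j = ≡.cong h (≡.trans (≡.cong (λ x → + x ℤ.- + toℕ i ℤ.+ + toℕ j) (List.lookup-applyDownFrom (λ i → p + i ℕ.* n) k i))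
      (index-identity (toℕ i) (toℕ j) refl (bound i) (bound j)))
      where
      bound : ∀ (i : Fin (length parts)) → toℕ i < k
      bound i = ≡.subst (toℕ i <_) L≡k (Fin.toℕ<n i)

  -- With this bound `frequency≡P` permits counting over tuples of length `N` in place of
  -- `maxIndex s`.
  schur-involves : InvolvesOnly N s
  schur-involves = s , ≈ᴾ-refl , within-det N jacobiTrudi λ i j →
    ≡.subst (Within N) (≡.sym (entry i j)) (within-h N (toℕ i ℕ.* suc n + (k ∸ suc (toℕ j))))

  -- The size of the Jacobi-Trudi matrix is the length of a list, equal to `k` only propositionally;
  -- with a variable `L` the equation can be matched with `refl`.
  det-windows : ∀ {L} → L ≡ k → ∀ g (A : Matrix L) →
    (∀ i j → A i j ≈ g (toℕ i ℕ.* suc n + (k ∸ suc (toℕ j)))) → det A ≈ det (windows g)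
  det-windows refl g A e = det-cong λ i j → ≈-trans (e i j)
    (reflexive (≡.cong (λ x → g (toℕ i ℕ.* suc n + x)) (≡.sym (Fin.opposite-prop j))))

  eval-schur : ∀ (z : Vec Carrier N) → eval (assign z) s ≈ det (windows (pushes h₀ z))
  eval-schur z = ≈-trans (eval-det (assign z) jacobiTrudi) (det-windows L≡k (pushes h₀ z) (λ i j → eval (assign z) (jacobiTrudi i j)) λ i j →
    ≈-trans (reflexive (≡.cong (eval (assign z)) (entry i j))) (eval-h z (toℕ i ℕ.* suc n + (k ∸ suc (toℕ j)))))

  #singular+#nonsingular : length (solutions N s 0#) + #nonsingular N h₀ ≡ q ℕ.^ N
  #singular+#nonsingular = begin
    length (solutions N s 0#) + #nonsingular N h₀    ≡⟨ ≡.cong (_+ #nonsingular N h₀) (count≡total N (λ ρ → eval ρ s ≟ 0#) singular h₀ agree) ⟩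
    total N singular h₀ + #nonsingular N h₀          ≡⟨ ≡.trans (ℕ.+-comm (total N singular h₀) _) (≡.sym (total-add N _ singular h₀)) ⟩
    total N (λ g → ⟦ nonsingular? g ⟧ + singular g) h₀ ≡⟨ total-cong N (λ g _ → ⟦⟧-¬ (det (windows g) ≟ 0#)) ⟩
    total N (λ _ → 1) h₀                             ≡⟨ total-const N 1 h₀ ⟩
    q ℕ.^ N ℕ.* 1                                    ≡⟨ ℕ.*-identityʳ (q ℕ.^ N) ⟩
    q ℕ.^ N                                          ∎
    where
    open ≡-Reasoning
    singular : Stream → ℕ
    singular g = ⟦ det (windows g) ≟ 0# ⟧
    agree : ∀ z → ⟦ eval (assign z) s ≟ 0# ⟧ ≡ singular (pushes h₀ z)
    agree z = ⟦⟧-cong (eval (assign z) s ≟ 0#) (det (windows (pushes h₀ z)) ≟ 0#)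
      (≈-trans (≈-sym (eval-schur z))) (≈-trans (eval-schur z))

  P-schur : ∀ r → #nonsingular N h₀ ℕ.* ∏qⁱ r ≡ q ℕ.^ N ℕ.* ∏[qⁱ-1] r → P s 0# ≡ 1ℚ - ∏[1-q⁻ⁱ] r
  P-schur r e = ≡.trans (≡.sym (frequency≡P N s 0# schur-involves))
    (Frequency.complementary-frequency F N r
      {length (solutions N s 0#)} {#nonsingular N h₀} #singular+#nonsingular e)

-- The two cases of the theorem

if-intro : ∀ {A : Set c} (B : A → Set ℓ) b {x y} → (T b → B x) → (¬ T b → B y) → B (if b then x else y)
if-intro B true  t _ = t tt
if-intro B false _ f = f λ ()

-- For k = 0 there is no first window, so this case stands apart: the empty determinant is 1 and
-- never vanishes.
empty-schur : ∀ {q} (F : FiniteField q c ℓ) p n .{{_ : NonZero p}} → let open FiniteField F using (0#); open Probability F in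
  P (schur (staircase p n 0)) 0# ≡ 1ℚ - 1ℚ
empty-schur {q = q} F p n = P-schur F p n 0 0 (≡.cong (ℕ._* 1) (≡.trans
  (total-cong (p + 0) λ g _ → ⟦⟧-yes (nonsingular? g) 1≉0) (≡.trans (total-const (p + 0) 1 h₀) (ℕ.*-identityʳ (q ℕ.^ (p + 0))))))
  where
  open FiniteField F using (1≉0)
  open Streams F
  open Sliding F 0 (suc n)

theorem3p2 : {c ℓ : Level} (q : ℕ) (F : FiniteField q c ℓ)
    (p n k : ℕ) .{{_ : NonZero p}} .{{_ : NonZero n}} →
    let open FiniteField F using (0#)
        open Probability F
        s = schur (staircase p n k)
    in (k < n + 1 →
          P s 0# ≡ 1ℚ - (if p ≤ᵇ k ∸ 1 then ∏[1-q⁻ⁱ] (k ∸ 1) else ∏[1-q⁻ⁱ] k))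
     × (p ≤ n → k ≥ n + 1 → P s 0# ≡ 1ℚ - ∏[1-q⁻ⁱ] n)
theorem3p2 q F p n zero =
    -- As `0 ∸ 1` is 0, both branches are the empty product.
    (λ _ → if-intro (λ x → P (schur (staircase p n 0)) 0# ≡ 1ℚ - x) (p ≤ᵇ 0) (λ _ → empty-schur F p n) (λ _ → empty-schur F p n))
  , λ _ 0≥n+1 → ⊥-elim (ℕ.1+n≢0 (≡.trans (ℕ.+-comm 1 n) (ℕ.n≤0⇒n≡0 0≥n+1)))
  where
  open FiniteField F using (0#)
  open Probability F
theorem3p2 q F p n k@(suc k′) = part-i , part-ii
  where
  open FiniteField F using (0#)
  open Probability F
  open PowerProducts q
  s = schur (staircase p n k)
  -- With h₀ in the bottom row the product has `k′ ⊓ n` factors: k - 1 of them in (i) and n in (ii).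
  short : ∀ r → p ≤ k′ → p ≤ n → k′ ℕ.⊓ n ≡ r → P s 0# ≡ 1ℚ - ∏[1-q⁻ⁱ] r
  short r p≤k′ p≤n refl = P-schur F p n k r (FirstRow.short-first-row F k′ n p p≤k′ p≤n)
  part-i : k < n + 1 → P s 0# ≡ 1ℚ - (if p ≤ᵇ k′ then ∏[1-q⁻ⁱ] k′ else ∏[1-q⁻ⁱ] k)
  part-i k<n+1 = if-intro (λ x → P s 0# ≡ 1ℚ - x) (p ≤ᵇ k′)
    (λ p≤ᵇk′ → short k′ (ℕ.≤ᵇ⇒≤ p k′ p≤ᵇk′) (ℕ.≤-trans (ℕ.≤ᵇ⇒≤ p k′ p≤ᵇk′) k′≤n) (ℕ.m≤n⇒m⊓n≡m k′≤n))
    -- Now `p` is at least `k`, so the bottom row stops short of h₀ and the factor for i = k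
    -- appears.
    (λ p≰ᵇk′ → P-schur F p n k k (FirstRow.long-first-row F k′ n p (ℕ.≰⇒> (p≰ᵇk′ ∘ ℕ.≤⇒≤ᵇ)) (s≤s k′≤n)))
    where
    k′≤n : k′ ≤ n
    k′≤n = ℕ.<⇒≤ (ℕ.s≤s⁻¹ (≡.subst (k <_) (ℕ.+-comm n 1) k<n+1))
  part-ii : p ≤ n → k ≥ n + 1 → P s 0# ≡ 1ℚ - ∏[1-q⁻ⁱ] n
  part-ii p≤n k≥n+1 = short n (ℕ.≤-trans p≤n n≤k′) p≤n (ℕ.m≥n⇒m⊓n≡n n≤k′)
    where
    n≤k′ : n ≤ k′
    n≤k′ = ℕ.s≤s⁻¹ (≡.subst (_≤ k) (ℕ.+-comm n 1) k≥n+1)
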